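{- The relation $\equiv_1$ of $1$-equivalence on $2^\mathbb{N}$ is $\Pi^0_2$-graphable with diameter $2$.
   Context: Subsets of $\mathbb{N}$ are identified with elements of $2^\mathbb{N}$. $A\equiv_1 B$ means there is a computable bijection $f:\mathbb{N}\to\mathbb{N}$ with $n\in A\iff f(n)\in B$ for all $n$. An equivalence relation $E$ on a space $X$ is $\Gamma$-graphable (for a pointclass $\Gamma$, here lightface $\Pi^0_2$) if there is a simple undirected graph $G\subseteq X\times X$ in $\Gamma$ whose connectedness relation (connected by a finite path) equals $E$; it is $\Gamma$-graphable with diameter $k$ if such a $G$ exists in which $k$ is the least integer such that any two $G$-connected points are joined by a path of length at most $k$. -}

module Defs where

open import Data.Bool using (Bool; true; false; T)
open import Data.Fin using (Fin)
open import Data.Fin.Patterns using (0F; 1F)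
open import Data.Nat using (ℕ; zero; suc; _≤_; _<_)
open import Data.Product using (∃-syntax; Σ-syntax; _×_)
open import Data.Vec using (Vec; []; _∷_; lookup)
open import Function.Bundles using (_⇔_)
open import Function.Definitions using (Bijective)
open import Level using (0ℓ)
open import Relation.Binary using (Rel; Setoid; Symmetric; Irreflexive; _Respects₂_)
open import Relation.Binary.PropositionalEquality using (_≡_; _→-setoid_)

-- 2^ℕ. As a setoid it carries pointwise equality of characteristic functions.

Cantor : Set
Cantor = ℕ → Bool

CantorSetoid : Setoid 0ℓ 0ℓ
CantorSetoid = ℕ →-setoid Bool

infix 4 _∈_

_∈_ : ℕ → Cantor → Set
n ∈ A = T (A n)

-- μ-recursive programs of arity m with access to k set oracles.

data Rec (k : ℕ) : ℕ → Set where
  zero′  : Rec k 0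
  suc′   : Rec k 1
  proj   : ∀ {m} → Fin m → Rec k m
  oracle : Fin k → Rec k 1
  comp   : ∀ {m n} → Rec k n → Vec (Rec k m) n → Rec k m
  prec   : ∀ {m} → Rec k m → Rec k (suc (suc m)) → Rec k (suc m)
  μ      : ∀ {m} → Rec k (suc m) → Rec k m

bit : Bool → ℕ
bit false = 0
bit true  = 1

-- Os ⊢ p [ xs ]↓ y : with oracles Os, the program p on input xs halts with
-- value y.  In prec and μ the recursion/search variable is the first argument;
-- the step function of prec receives (n , previous value , xs).

infix 4 _⊢_[_]↓_ _⊢_[_]↓*_

mutual

  data _⊢_[_]↓_ {k} (Os : Vec Cantor k) : ∀ {m} → Rec k m → Vec ℕ m → ℕ → Set where
    zero↓   : Os ⊢ zero′ [ [] ]↓ 0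
    suc↓    : ∀ {x} → Os ⊢ suc′ [ x ∷ [] ]↓ suc x
    proj↓   : ∀ {m} {i : Fin m} {xs} → Os ⊢ proj i [ xs ]↓ lookup xs i
    oracle↓ : ∀ {i x} → Os ⊢ oracle i [ x ∷ [] ]↓ bit (lookup Os i x)
    comp↓   : ∀ {m n} {f : Rec k n} {gs : Vec (Rec k m) n} {xs ys z} →
              Os ⊢ gs [ xs ]↓* ys → Os ⊢ f [ ys ]↓ z →
              Os ⊢ comp f gs [ xs ]↓ z
    prec↓0  : ∀ {m} {f : Rec k m} {g xs y} →
              Os ⊢ f [ xs ]↓ y →
              Os ⊢ prec f g [ 0 ∷ xs ]↓ y
    prec↓s  : ∀ {m} {f : Rec k m} {g n xs y z} →
              Os ⊢ prec f g [ n ∷ xs ]↓ y → Os ⊢ g [ n ∷ y ∷ xs ]↓ z →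
              Os ⊢ prec f g [ suc n ∷ xs ]↓ z
    μ↓      : ∀ {m} {f : Rec k (suc m)} {xs n} →
              (∀ i → i < n → ∃[ y ] Os ⊢ f [ i ∷ xs ]↓ suc y) →
              Os ⊢ f [ n ∷ xs ]↓ 0 →
              Os ⊢ μ f [ xs ]↓ n

  data _⊢_[_]↓*_ {k} (Os : Vec Cantor k) {m} :
       ∀ {n} → Vec (Rec k m) n → Vec ℕ m → Vec ℕ n → Set where
    []↓ : ∀ {xs} → Os ⊢ [] [ xs ]↓* []
    ∷↓  : ∀ {n g} {gs : Vec (Rec k m) n} {xs y ys} →
          Os ⊢ g [ xs ]↓ y → Os ⊢ gs [ xs ]↓* ys →
          Os ⊢ g ∷ gs [ xs ]↓* y ∷ ys

Computable : (ℕ → ℕ) → Set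
Computable f = Σ[ p ∈ Rec 0 1 ] (∀ n → [] ⊢ p [ n ∷ [] ]↓ f n)

infix 4 _≡₁_

_≡₁_ : Rel Cantor 0ℓ
A ≡₁ B = ∃[ f ] Computable f × Bijective _≡_ _≡_ f × (∀ n → n ∈ A ⇔ f n ∈ B)

-- Lightface pointclasses on the spaces (2^ℕ)^k × ℕ^m.  Σ⁰₁ is the class of
-- semirecursive sets (domains of partial recursive functions with the points
-- of 2^ℕ as oracles), and Π⁰₂ = ∀^ℕ Σ⁰₁.

PointSet : ℕ → ℕ → Set₁
PointSet k m = Vec Cantor k → Vec ℕ m → Set

Σ⁰₁ : ∀ {k m} → PointSet k m → Set
Σ⁰₁ {k} {m} P = Σ[ p ∈ Rec k m ] (∀ Xs xs → P Xs xs ⇔ (∃[ y ] Xs ⊢ p [ xs ]↓ y))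

Π⁰₂ : ∀ {k m} → PointSet k m → Set₁
Π⁰₂ {k} {m} P =
  Σ[ Q ∈ PointSet k (suc m) ] Σ⁰₁ Q × (∀ Xs xs → P Xs xs ⇔ (∀ n → Q Xs (n ∷ xs)))

Π⁰₂-Rel : Rel Cantor 0ℓ → Set₁
Π⁰₂-Rel G = Π⁰₂ {2} {0} (λ Xs _ → G (lookup Xs 0F) (lookup Xs 1F))

module Graphs (X : Setoid 0ℓ 0ℓ) where

  open Setoid X renaming (Carrier to V)

  record IsSimpleGraph (G : Rel V 0ℓ) : Set where
    field
      sym-edge   : Symmetric G
      irrefl     : Irreflexive _≈_ G
      resp-≈     : G Respects₂ _≈_

  data Path (G : Rel V 0ℓ) : ℕ → Rel V 0ℓ where
    stop : ∀ {x y} → x ≈ y → Path G 0 x y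
    step : ∀ {n x y z} → G x y → Path G n y z → Path G (suc n) x z

  Connected : Rel V 0ℓ → Rel V 0ℓ
  Connected G x y = ∃[ n ] Path G n x y

  DiameterAtMost : Rel V 0ℓ → ℕ → Set
  DiameterAtMost G d = ∀ x y → Connected G x y → ∃[ n ] n ≤ d × Path G n x y

  HasDiameter : Rel V 0ℓ → ℕ → Set
  HasDiameter G d = DiameterAtMost G d × (∀ j → DiameterAtMost G j → d ≤ j)

  GraphableWithDiameter : (Rel V 0ℓ → Set₁) → Rel V 0ℓ → ℕ → Set₁
  GraphableWithDiameter Γ E d =
    Σ[ G ∈ Rel V 0ℓ ]
      IsSimpleGraph G × Γ G × (∀ x y → E x y ⇔ Connected G x y) × HasDiameter G d

open Graphs CantorSetoid public using (GraphableWithDiameter)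

{-# OPTIONS --safe #-}

-- Say that C has code e if C is constant on [0, e + 2) and changes at e + 2.  Let e list (indices for)
-- two computable permutations.  Join X to C when C has a code e and C is a finite rearrangement of
-- X ∘ f for one of the permutations f listed by e.  The end of the rearrangement has to be found
-- effectively: it is the first N > e + 2 at which C and X ∘ f have equally many elements below N.
-- "f is a total bijection" and "C = X ∘ f beyond N" are then Π⁰₂.  If A = B ∘ f is not constant,
-- rearranging an initial segment of A gives a set C with the code e that lists id and f, and A – C – B.
-- Equal counts below N and equality beyond N yield a computable permutation by sorting, so adjacent
-- sets are 1-equivalent.  Sets such as {0} and {1}, which have no code, are never adjacent to each other.
module Submission where

open import Axiom.ExcludedMiddle using (ExcludedMiddle)
open import Data.Bool using (true; false; not; T; if_then_else_) renaming (_≟_ to _≟ᵇ_)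
open import Data.Bool.Properties using (¬-not; not-involutive; not-injective)
open import Data.Empty using (⊥-elim)
open import Data.Fin using (Fin; zero; suc)
open import Data.Fin.Patterns using (0F; 1F; 2F; 3F; 4F; 5F; 6F)
open import Data.Nat using (ℕ; zero; suc; pred; _+_; _*_; _∸_; _≤_; _<_; z≤n; s≤s; _<?_; _≤?_; _≟_)
open import Data.Nat.Properties
open import Data.Product using (∃-syntax; _×_; _,_; proj₁; proj₂)
open import Data.Sum using (_⊎_; inj₁; inj₂)
open import Data.Unit using (tt)
open import Data.Vec using (Vec; []; _∷_; lookup; tabulate; tail)
open import Data.Vec.Properties using (tabulate∘lookup)
open import Function.Base using (_∘_; id)
open import Function.Bundles using (_⇔_; mk⇔; module Equivalence)
open import Function.Definitions using (Bijective)
open import Level using (0ℓ)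
open import Relation.Binary using (Rel; tri<; tri≈; tri>)
open import Relation.Binary.PropositionalEquality
open import Relation.Nullary using (¬_; yes; no; does; contradiction)
open import Relation.Nullary.Decidable using (dec-true; dec-false)
open import Defs

-- Determinism of program evaluation.

mutual

  ↓-functional : ∀ {k m} {Os : Vec Cantor k} {p : Rec k m} {xs y z} →
                 Os ⊢ p [ xs ]↓ y → Os ⊢ p [ xs ]↓ z → y ≡ z
  ↓-functional zero↓ zero↓ = refl
  ↓-functional suc↓ suc↓ = refl
  ↓-functional proj↓ proj↓ = refl
  ↓-functional oracle↓ oracle↓ = refl
  ↓-functional (comp↓ gs f) (comp↓ gs′ f′) with refl ← ↓*-functional gs gs′ = ↓-functional f f′
  ↓-functional (prec↓0 f) (prec↓0 f′) = ↓-functional f f′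
  ↓-functional (prec↓s r g) (prec↓s r′ g′) with refl ← ↓-functional r r′ = ↓-functional g g′
  ↓-functional (μ↓ {n = n} below at) (μ↓ {n = n′} below′ at′) with <-cmp n n′
  ... | tri≈ _ n≡n′ _ = n≡n′
  ... | tri< n<n′ _ _ = contradiction (↓-functional at (proj₂ (below′ n n<n′))) λ ()
  ... | tri> _ _ n′<n = contradiction (↓-functional (proj₂ (below n′ n′<n)) at′) λ ()

  ↓*-functional : ∀ {k m n} {Os : Vec Cantor k} {gs : Vec (Rec k m) n} {xs ys zs} →
                  Os ⊢ gs [ xs ]↓* ys → Os ⊢ gs [ xs ]↓* zs → ys ≡ zs
  ↓*-functional []↓ []↓ = refl
  ↓*-functional (∷↓ g gs) (∷↓ g′ gs′) = cong₂ _∷_ (↓-functional g g′) (↓*-functional gs gs′)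

-- Total computable functions

-- The computed function is an index of the type, so a program is assembled by mirroring the
-- expression that defines its function, and its correctness comes along.
record Fun (k m : ℕ) (f : Vec Cantor k → Vec ℕ m → ℕ) : Set where
  constructor mkFun
  field
    prog    : Rec k m
    correct : ∀ Os xs → Os ⊢ prog [ xs ]↓ f Os xs

open Fun

infixr 5 _∷_

data Funs (k m : ℕ) : (n : ℕ) → (Vec Cantor k → Vec ℕ m → Vec ℕ n) → Set where
  []  : Funs k m 0 (λ _ _ → [])
  _∷_ : ∀ {n f fs} → Fun k m f → Funs k m n fs → Funs k m (suc n) (λ Os xs → f Os xs ∷ fs Os xs)

progs : ∀ {k m n fs} → Funs k m n fs → Vec (Rec k m) n
progs []       = []
progs (f ∷ fs) = prog f ∷ progs fs

progs-correct : ∀ {k m n fs} (F : Funs k m n fs) Os xs → Os ⊢ progs F [ xs ]↓* fs Os xs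
progs-correct []       Os xs = []↓
progs-correct (f ∷ fs) Os xs = ∷↓ (correct f Os xs) (progs-correct fs Os xs)

projs-correct : ∀ {k m n} {Os : Vec Cantor k} (ρ : Fin n → Fin m) xs →
                Os ⊢ tabulate (λ i → proj (ρ i)) [ xs ]↓* tabulate (λ i → lookup xs (ρ i))
projs-correct {n = zero}  ρ xs = []↓
projs-correct {n = suc n} ρ xs = ∷↓ proj↓ (projs-correct (λ i → ρ (suc i)) xs)

var : ∀ {k m} (i : Fin m) → Fun k m (λ _ xs → lookup xs i)
var i = mkFun (proj i) (λ _ _ → proj↓)

infixl 8 _⦅_⦆

_⦅_⦆ : ∀ {k m n f gs} → Fun k n f → Funs k m n gs → Fun k m (λ Os xs → f Os (gs Os xs))
F ⦅ G ⦆ = mkFun (comp (prog F) (progs G)) λ Os xs →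
  comp↓ (progs-correct G Os xs) (correct F Os _)

Fun-ext : ∀ {k m f g} → (∀ Os xs → f Os xs ≡ g Os xs) → Fun k m f → Fun k m g
Fun-ext f≗g F = mkFun (prog F) λ Os xs → subst (_ ⊢ _ [ _ ]↓_) (f≗g Os xs) (correct F Os xs)

primrec : ℕ → (ℕ → ℕ → ℕ) → ℕ → ℕ
primrec b s zero    = b
primrec b s (suc n) = s n (primrec b s n)

primrecF : ∀ {k m b s n} → Fun k m b → Fun k (suc (suc m)) s → Fun k m n →
           Fun k m (λ Os xs → primrec (b Os xs) (λ i y → s Os (i ∷ y ∷ xs)) (n Os xs))
primrecF {k} {m} {b} {s} {n} B S N =
  mkFun (comp (prec (prog B) (prog S)) (prog N ∷ tabulate proj)) λ Os xs →
    comp↓ (∷↓ (correct N Os xs)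
              (subst (_ ⊢ _ [ _ ]↓*_) (tabulate∘lookup xs) (projs-correct id xs)))
          (loop Os xs (n Os xs))
  where
  loop : ∀ Os xs c → Os ⊢ prec (prog B) (prog S) [ c ∷ xs ]↓
                       primrec (b Os xs) (λ i y → s Os (i ∷ y ∷ xs)) c
  loop Os xs zero    = prec↓0 (correct B Os xs)
  loop Os xs (suc c) = prec↓s (loop Os xs c) (correct S Os _)

sum< : ℕ → (ℕ → ℕ) → ℕ
sum< n h = primrec 0 (λ i y → y + h i) n

dist : ℕ → ℕ → ℕ
dist m n = (m ∸ n) + (n ∸ m)

ifz : ℕ → ℕ → ℕ → ℕ
ifz zero    x y = x
ifz (suc _) x y = y

sucF : ∀ {k} → Fun k 1 (λ _ v → suc (lookup v 0F))
sucF = mkFun suc′ λ { _ (x ∷ []) → suc↓ }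

oracleF : ∀ {k} (i : Fin k) → Fun k 1 (λ Os v → bit (lookup Os i (lookup v 0F)))
oracleF i = mkFun (oracle i) λ { _ (x ∷ []) → oracle↓ }

constF : ∀ {k m} n → Fun k m (λ _ _ → n)
constF zero    = mkFun (comp zero′ []) λ _ _ → comp↓ []↓ zero↓
constF (suc n) = sucF ⦅ constF n ∷ [] ⦆

predF : ∀ {k} → Fun k 1 (λ _ v → pred (lookup v 0F))
predF = Fun-ext (λ _ v → eq (lookup v 0F)) (primrecF (constF 0) (var 0F) (var 0F))
  where
  eq : ∀ n → primrec 0 (λ i _ → i) n ≡ pred n
  eq zero    = refl
  eq (suc n) = refl

+F : ∀ {k} → Fun k 2 (λ _ v → lookup v 0F + lookup v 1F)
+F = Fun-ext (λ _ v → eq (lookup v 0F) (lookup v 1F))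
             (primrecF (var 1F) (sucF ⦅ var 1F ∷ [] ⦆) (var 0F))
  where
  eq : ∀ m n → primrec n (λ _ y → suc y) m ≡ m + n
  eq zero    n = refl
  eq (suc m) n = cong suc (eq m n)

∸F : ∀ {k} → Fun k 2 (λ _ v → lookup v 0F ∸ lookup v 1F)
∸F = Fun-ext (λ _ v → eq (lookup v 0F) (lookup v 1F))
             (primrecF (var 0F) (predF ⦅ var 1F ∷ [] ⦆) (var 1F))
  where
  eq : ∀ m n → primrec m (λ _ y → pred y) n ≡ m ∸ n
  eq m zero    = refl
  eq m (suc n) = trans (cong pred (eq m n)) (pred[m∸n]≡m∸[1+n] m n)

*F : ∀ {k} → Fun k 2 (λ _ v → lookup v 0F * lookup v 1F)
*F = Fun-ext (λ _ v → eq (lookup v 0F) (lookup v 1F))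
             (primrecF (constF 0) (+F ⦅ var 3F ∷ var 1F ∷ [] ⦆) (var 0F))
  where
  eq : ∀ m n → primrec 0 (λ _ y → n + y) m ≡ m * n
  eq zero    n = refl
  eq (suc m) n = cong (n +_) (eq m n)

distF : ∀ {k} → Fun k 2 (λ _ v → dist (lookup v 0F) (lookup v 1F))
distF = +F ⦅ ∸F ⦅ var 0F ∷ var 1F ∷ [] ⦆ ∷ ∸F ⦅ var 1F ∷ var 0F ∷ [] ⦆ ∷ [] ⦆

ifzF : ∀ {k} → Fun k 3 (λ _ v → ifz (lookup v 0F) (lookup v 1F) (lookup v 2F))
ifzF = Fun-ext (λ _ v → eq (lookup v 0F) (lookup v 1F) (lookup v 2F))
               (primrecF (var 1F) (var 4F) (var 0F))
  where
  eq : ∀ n x y → primrec x (λ _ _ → y) n ≡ ifz n x y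
  eq zero    x y = refl
  eq (suc n) x y = refl

sum<F : ∀ {k m h n} → Fun k (suc m) h → Fun k m n →
        Fun k m (λ Os xs → sum< (n Os xs) (λ i → h Os (i ∷ xs)))
sum<F {k} {m} {h} H N = primrecF (constF 0) (+F ⦅ var 1F ∷ weakened ∷ [] ⦆) N
  where
  -- The recursion step also receives the accumulator, which is projected away before `H` is
  -- applied.
  weakened : Fun k (suc (suc m)) (λ Os xs → h Os (lookup xs 0F ∷ tail (tail xs)))
  weakened = mkFun (comp (prog H) (proj 0F ∷ tabulate (λ i → proj (suc (suc i))))) λ where
    Os (i ∷ y ∷ xs) →
      comp↓ (∷↓ proj↓ (subst (Os ⊢ _ [ i ∷ y ∷ xs ]↓*_) (tabulate∘lookup xs)
                             (projs-correct (λ i → suc (suc i)) (i ∷ y ∷ xs))))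
            (correct H Os (i ∷ xs))

dist≡0⇒≡ : ∀ m n → dist m n ≡ 0 → m ≡ n
dist≡0⇒≡ m n eq = ≤-antisym (m∸n≡0⇒m≤n (m+n≡0⇒m≡0 (m ∸ n) eq)) (m∸n≡0⇒m≤n (m+n≡0⇒n≡0 (m ∸ n) eq))

dist-self : ∀ n → dist n n ≡ 0
dist-self n = cong₂ _+_ (n∸n≡0 n) (n∸n≡0 n)

sum<-cong : ∀ {h h′} n → (∀ i → i < n → h i ≡ h′ i) → sum< n h ≡ sum< n h′
sum<-cong zero    eq = refl
sum<-cong (suc n) eq = cong₂ _+_ (sum<-cong n λ i i<n → eq i (m<n⇒m<1+n i<n)) (eq n ≤-refl)

sum<≡0 : ∀ {h} n → (∀ i → i < n → h i ≡ 0) → sum< n h ≡ 0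
sum<≡0 zero    eq = refl
sum<≡0 (suc n) eq = cong₂ _+_ (sum<≡0 n λ i i<n → eq i (m<n⇒m<1+n i<n)) (eq n ≤-refl)

sum<≡0⁻¹ : ∀ {h} n → sum< n h ≡ 0 → ∀ i → i < n → h i ≡ 0
sum<≡0⁻¹ {h} (suc n) eq i i<1+n with m≤n⇒m<n∨m≡n (≤-pred i<1+n)
... | inj₁ i<n  = sum<≡0⁻¹ n (m+n≡0⇒m≡0 (sum< n h) eq) i i<n
... | inj₂ refl = m+n≡0⇒n≡0 (sum< n h) eq

-- The earlier values are returned as successors, the form that `μ↓` asks for.
least-zero : (h : ℕ → ℕ) → ∀ n → h n ≡ 0 →
             ∃[ m ] h m ≡ 0 × (∀ i → i < m → ∃[ y ] h i ≡ suc y)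
least-zero h zero eq = 0 , eq , λ _ ()
least-zero h (suc n) eq with h 0 in h0
... | zero  = 0 , h0 , λ _ ()
... | suc y with least-zero (h ∘ suc) n eq
...   | m , at , below = suc m , at , λ where
        zero    _         → y , h0
        (suc i) (s≤s i<m) → below i i<m

μ-halts : ∀ {k m f} (F : Fun k (suc m) f) Os xs n → f Os (n ∷ xs) ≡ 0 →
          ∃[ y ] f Os (y ∷ xs) ≡ 0 × Os ⊢ μ (prog F) [ xs ]↓ y
μ-halts F Os xs n eq with least-zero _ n eq
... | y , at , below = y , at ,
  μ↓ (λ i i<y → proj₁ (below i i<y) , subst (_ ⊢ _ [ _ ]↓_) (proj₂ (below i i<y)) (correct F Os _))
     (subst (_ ⊢ _ [ _ ]↓_) at (correct F Os _))

-- Pairing: (a + b)² ≤ (a + b)² + a < (a + b + 1)², so a + b is the integer square root of the code.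

isqrt : ℕ → ℕ
isqrt = primrec 0 (λ i y → ifz (suc y * suc y ∸ suc i) (suc y) y)

isqrt-spec : ∀ n → isqrt n * isqrt n ≤ n × n < suc (isqrt n) * suc (isqrt n)
isqrt-spec zero = z≤n , s≤s z≤n
isqrt-spec (suc n) with isqrt n | isqrt-spec n
... | y | lo , hi with suc y * suc y ∸ suc n in eq
...   | zero  = m∸n≡0⇒m≤n eq , ≤-<-trans hi (*-mono-< {suc y} ≤-refl ≤-refl)
...   | suc _ = m≤n⇒m≤1+n lo , ≰⇒> λ le → contradiction (trans (sym eq) (m≤n⇒m∸n≡0 le)) λ ()

isqrt-unique : ∀ {s n} → s * s ≤ n → n < suc s * suc s → isqrt n ≡ s
isqrt-unique {s} {n} lo hi with <-cmp (isqrt n) s | isqrt-spec n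
... | tri≈ _ eq _ | _ = eq
... | tri< lt _ _ | _ , hi′ = contradiction (<-≤-trans hi′ (≤-trans (*-mono-≤ lt lt) lo)) (<-irrefl refl)
... | tri> _ _ gt | lo′ , _ = contradiction (<-≤-trans hi (≤-trans (*-mono-≤ gt gt) lo′)) (<-irrefl refl)

-- What follows relies only on the two projection laws and on the computability of pairing and
-- projections.
opaque

  ⟨_,_⟩ : ℕ → ℕ → ℕ
  ⟨ a , b ⟩ = (a + b) * (a + b) + a

  π₁ π₂ : ℕ → ℕ
  π₁ n = n ∸ isqrt n * isqrt n
  π₂ n = isqrt n ∸ π₁ n

  isqrt-pair : ∀ a b → isqrt ⟨ a , b ⟩ ≡ a + b
  isqrt-pair a b = isqrt-unique (m≤m+n _ a)
    (s≤s (≤-trans (+-monoʳ-≤ ((a + b) * (a + b)) (m≤m+n a b))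
                  (≤-trans (≤-reflexive (+-comm ((a + b) * (a + b)) (a + b)))
                    (≤-trans (m≤n+m _ (a + b))
                      (+-monoʳ-≤ (a + b) (≤-reflexive (sym (*-suc (a + b) (a + b)))))))))

  π₁-pair : ∀ a b → π₁ ⟨ a , b ⟩ ≡ a
  π₁-pair a b rewrite isqrt-pair a b = m+n∸m≡n ((a + b) * (a + b)) a

  π₂-pair : ∀ a b → π₂ ⟨ a , b ⟩ ≡ b
  π₂-pair a b = trans (cong₂ _∸_ (isqrt-pair a b) (π₁-pair a b)) (m+n∸m≡n a b)

  pairF : ∀ {k} → Fun k 2 (λ _ v → ⟨ lookup v 0F , lookup v 1F ⟩)
  pairF = +F ⦅ *F ⦅ +F ∷ +F ∷ [] ⦆ ∷ var 0F ∷ [] ⦆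

  isqrtF : ∀ {k} → Fun k 1 (λ _ v → isqrt (lookup v 0F))
  isqrtF = primrecF (constF 0) (ifzF ⦅ ∸F ⦅ *F ⦅ s ∷ s ∷ [] ⦆ ∷ sucF ⦅ var 0F ∷ [] ⦆ ∷ [] ⦆ ∷ s ∷ var 1F ∷ [] ⦆) (var 0F)
    where
    s : ∀ {k} → Fun k 3 (λ _ v → suc (lookup v 1F))
    s = sucF ⦅ var 1F ∷ [] ⦆

  π₁F : ∀ {k} → Fun k 1 (λ _ v → π₁ (lookup v 0F))
  π₁F = ∸F ⦅ var 0F ∷ *F ⦅ isqrtF ∷ isqrtF ∷ [] ⦆ ∷ [] ⦆

  π₂F : ∀ {k} → Fun k 1 (λ _ v → π₂ (lookup v 0F))
  π₂F = ∸F ⦅ isqrtF ∷ π₁F ∷ [] ⦆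

-- A stack machine executing programs

-- The control stack is 0 when empty and suc ⟨ item , rest ⟩ otherwise; an item ⟨ tag , a ⟩ consumes
-- the value register v and leaves its result there.  Items 6, 7, 9 and 12 are continuations.

push : ℕ → ℕ → ℕ
push i K = suc ⟨ i , K ⟩

-- Tags: 0 zero or empty tuple, 1 successor, 2 head, 3 tail, 4 composition, 5 nonempty tuple of
-- programs (continued by 6 and 7), 8 primitive recursion (continued by 9), 10 start of a
-- minimisation, 11 test of one candidate, 12 inspection of its result. The first vanishing `t ∸ j`
-- identifies the tag, because smaller tags were caught before.
exec : (tag a K v : ℕ) → ℕ
exec t a K v =
  ifz t                  ⟨ K , 0 ⟩
  (ifz (t ∸ 1)           ⟨ K , suc (π₁ v) ⟩
  (ifz (t ∸ 2)           ⟨ K , π₁ v ⟩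
  (ifz (t ∸ 3)           ⟨ K , π₂ v ⟩
  (ifz (t ∸ 4)           ⟨ push (π₂ a) (push (π₁ a) K) , v ⟩
  (ifz (t ∸ 5)           ⟨ push (π₁ a) (push ⟨ 6 , ⟨ π₂ a , v ⟩ ⟩ K) , v ⟩
  (ifz (t ∸ 6)           ⟨ push (π₁ a) (push ⟨ 7 , v ⟩ K) , π₂ a ⟩
  (ifz (t ∸ 7)           ⟨ K , ⟨ a , v ⟩ ⟩
  (ifz (t ∸ 8)           (ifz (π₁ v)
                              ⟨ push (π₁ a) K , π₂ v ⟩
                              ⟨ push ⟨ 8 , a ⟩ (push ⟨ 9 , ⟨ π₂ a , ⟨ pred (π₁ v) , π₂ v ⟩ ⟩ ⟩ K)
                              , ⟨ pred (π₁ v) , π₂ v ⟩ ⟩)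
  (ifz (t ∸ 9)           ⟨ push (π₁ a) K , ⟨ π₁ (π₂ a) , ⟨ v , π₂ (π₂ a) ⟩ ⟩ ⟩
  (ifz (t ∸ 10)          ⟨ push ⟨ 11 , a ⟩ K , ⟨ 0 , v ⟩ ⟩
  (ifz (t ∸ 11)          ⟨ push a (push ⟨ 12 , ⟨ a , v ⟩ ⟩ K) , v ⟩
                         (ifz v
                              ⟨ K , π₁ (π₂ a) ⟩
                              ⟨ push ⟨ 11 , π₁ a ⟩ K , ⟨ suc (π₁ (π₂ a)) , π₂ (π₂ a) ⟩ ⟩))))))))))))

-- A configuration with empty control stack is a fixed point; this makes `eval` monotone in the
-- number of steps.
transition : ℕ → ℕ
transition c = ifz (π₁ c) c
  (exec (π₁ (π₁ (pred (π₁ c)))) (π₂ (π₁ (pred (π₁ c)))) (π₂ (pred (π₁ c))) (π₂ c))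

run : ℕ → ℕ → ℕ
run s c = primrec c (λ _ y → transition y) s

output : ℕ → ℕ
output c = ifz (π₁ c) (suc (π₂ c)) 0

-- The value is suc y if the program coded by p returns y on n within s steps, and 0 otherwise.
eval : (s p n : ℕ) → ℕ
eval s p n = output (run s ⟨ push p 0 , ⟨ n , 0 ⟩ ⟩)

infixr 5 _▹_
infix  1 if₀_then_else_

if₀_then_else_ : ∀ {k m c x y} → Fun k m c → Fun k m x → Fun k m y →
                 Fun k m (λ Os xs → ifz (c Os xs) (x Os xs) (y Os xs))
if₀ C then X else Y = ifzF ⦅ C ∷ X ∷ Y ∷ [] ⦆

cfg : ∀ {k m x y} → Fun k m x → Fun k m y → Fun k m (λ Os xs → ⟨ x Os xs , y Os xs ⟩)
cfg X Y = pairF ⦅ X ∷ Y ∷ [] ⦆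

_▹_ : ∀ {k m x y} → Fun k m x → Fun k m y → Fun k m (λ Os xs → push (x Os xs) (y Os xs))
X ▹ Y = sucF ⦅ cfg X Y ∷ [] ⦆

fst : ∀ {k m x} → Fun k m x → Fun k m (λ Os xs → π₁ (x Os xs))
fst X = π₁F ⦅ X ∷ [] ⦆

snd : ∀ {k m x} → Fun k m x → Fun k m (λ Os xs → π₂ (x Os xs))
snd X = π₂F ⦅ X ∷ [] ⦆

execF : ∀ {k} → Fun k 4 (λ _ v → exec (lookup v 0F) (lookup v 1F) (lookup v 2F) (lookup v 3F))
execF =
  if₀ t                                 then cfg K (constF 0)
  else (if₀ ∸F ⦅ t ∷ constF 1 ∷ [] ⦆     then cfg K (sucF ⦅ fst v ∷ [] ⦆)
  else (if₀ ∸F ⦅ t ∷ constF 2 ∷ [] ⦆     then cfg K (fst v)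
  else (if₀ ∸F ⦅ t ∷ constF 3 ∷ [] ⦆     then cfg K (snd v)
  else (if₀ ∸F ⦅ t ∷ constF 4 ∷ [] ⦆     then cfg (snd a ▹ fst a ▹ K) v
  else (if₀ ∸F ⦅ t ∷ constF 5 ∷ [] ⦆     then cfg (fst a ▹ cfg (constF 6) (cfg (snd a) v) ▹ K) v
  else (if₀ ∸F ⦅ t ∷ constF 6 ∷ [] ⦆     then cfg (fst a ▹ cfg (constF 7) v ▹ K) (snd a)
  else (if₀ ∸F ⦅ t ∷ constF 7 ∷ [] ⦆     then cfg K (cfg a v)
  else (if₀ ∸F ⦅ t ∷ constF 8 ∷ [] ⦆     then (if₀ fst v
                                              then cfg (fst a ▹ K) (snd v)
                                              else cfg (cfg (constF 8) a ▹ cfg (constF 9) (cfg (snd a) v⁻) ▹ K) v⁻)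
  else (if₀ ∸F ⦅ t ∷ constF 9 ∷ [] ⦆     then cfg (fst a ▹ K) (cfg (fst (snd a)) (cfg v (snd (snd a))))
  else (if₀ ∸F ⦅ t ∷ constF 10 ∷ [] ⦆    then cfg (cfg (constF 11) a ▹ K) (cfg (constF 0) v)
  else (if₀ ∸F ⦅ t ∷ constF 11 ∷ [] ⦆    then cfg (a ▹ cfg (constF 12) (cfg a v) ▹ K) v
  else (if₀ v then cfg K (fst (snd a))
             else cfg (cfg (constF 11) (fst a) ▹ K) (cfg (sucF ⦅ fst (snd a) ∷ [] ⦆) (snd (snd a)))))))))))))))
  where
  t = var {m = 4} 0F
  a = var {m = 4} 1F
  K = var {m = 4} 2F
  v = var {m = 4} 3F
  v⁻ = cfg (predF ⦅ fst v ∷ [] ⦆) (snd v)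

transitionF : ∀ {k} → Fun k 1 (λ _ v → transition (lookup v 0F))
transitionF = ifzF ⦅ π₁F ∷ var 0F ∷ execF ⦅ π₁F ⦅ π₁F ⦅ K⁻ ∷ [] ⦆ ∷ [] ⦆ ∷ π₂F ⦅ π₁F ⦅ K⁻ ∷ [] ⦆ ∷ [] ⦆
                                    ∷ π₂F ⦅ K⁻ ∷ [] ⦆ ∷ π₂F ∷ [] ⦆ ∷ [] ⦆
  where K⁻ = predF ⦅ π₁F ∷ [] ⦆

evalF : ∀ {k} → Fun k 3 (λ _ v → eval (lookup v 0F) (lookup v 1F) (lookup v 2F))
evalF = ifzF ⦅ π₁F ⦅ final ∷ [] ⦆ ∷ sucF ⦅ π₂F ⦅ final ∷ [] ⦆ ∷ [] ⦆ ∷ constF 0 ∷ [] ⦆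
  where
  start = pairF ⦅ sucF ⦅ pairF ⦅ var 1F ∷ constF 0 ∷ [] ⦆ ∷ [] ⦆ ∷ pairF ⦅ var 2F ∷ constF 0 ∷ [] ⦆ ∷ [] ⦆
  final = primrecF start (transitionF ⦅ var 1F ∷ [] ⦆) (var 0F)

-- Codes of programs and the simulation by the machine.

mutual

  ⌜_⌝ : ∀ {m} → Rec 0 m → ℕ
  ⌜ zero′ ⌝        = ⟨ 0 , 0 ⟩
  ⌜ suc′ ⌝         = ⟨ 1 , 0 ⟩
  ⌜ proj i ⌝       = ⌜proj i ⌝
  ⌜ comp f gs ⌝    = ⟨ 4 , ⟨ ⌜ f ⌝ , ⌜ gs ⌝* ⟩ ⟩
  ⌜ prec f g ⌝     = ⟨ 8 , ⟨ ⌜ f ⌝ , ⌜ g ⌝ ⟩ ⟩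
  ⌜ μ f ⌝          = ⟨ 10 , ⌜ f ⌝ ⟩

  -- Arguments arrive as nested pairs `⟪ xs ⟫`, so a projection is a head taken after the right
  -- number of tails. In a tag 4 item the second component runs first.
  ⌜proj_⌝ : ∀ {m} → Fin m → ℕ
  ⌜proj zero ⌝  = ⟨ 2 , 0 ⟩
  ⌜proj suc i ⌝ = ⟨ 4 , ⟨ ⌜proj i ⌝ , ⟨ 3 , 0 ⟩ ⟩ ⟩

  ⌜_⌝* : ∀ {m n} → Vec (Rec 0 m) n → ℕ
  ⌜ [] ⌝*     = ⟨ 0 , 0 ⟩
  ⌜ g ∷ gs ⌝* = ⟨ 5 , ⟨ ⌜ g ⌝ , ⌜ gs ⌝* ⟩ ⟩

⟪_⟫ : ∀ {m} → Vec ℕ m → ℕ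
⟪ [] ⟫     = 0
⟪ x ∷ xs ⟫ = ⟨ x , ⟪ xs ⟫ ⟩

infix 4 _↠_

_↠_ : ℕ → ℕ → Set
c ↠ c′ = ∃[ t ] run t c ≡ c′

run-+ : ∀ t s c → run t (run s c) ≡ run (t + s) c
run-+ zero    s c = refl
run-+ (suc t) s c = cong transition (run-+ t s c)

infixr 5 _⨾_

_⨾_ : ∀ {a b c} → a ↠ b → b ↠ c → a ↠ c
(s , refl) ⨾ (t , eq) = t + s , trans (sym (run-+ t s _)) eq

transition-exec : ∀ t a K v → transition ⟨ push ⟨ t , a ⟩ K , v ⟩ ≡ exec t a K v
transition-exec t a K v
  rewrite π₁-pair (push ⟨ t , a ⟩ K) v | π₂-pair (push ⟨ t , a ⟩ K) v
        | π₁-pair ⟨ t , a ⟩ K | π₂-pair ⟨ t , a ⟩ K | π₁-pair t a | π₂-pair t a = refl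

by : ∀ {t a K v c} → exec t a K v ≡ c → ⟨ push ⟨ t , a ⟩ K , v ⟩ ↠ c
by eq = 1 , trans (transition-exec _ _ _ _) eq

exec-comp : ∀ f g K v → exec 4 ⟨ f , g ⟩ K v ≡ ⟨ push g (push f K) , v ⟩
exec-comp f g K v rewrite π₁-pair f g | π₂-pair f g = refl

simulate-proj : ∀ {m} (i : Fin m) xs K → ⟨ push ⌜proj i ⌝ K , ⟪ xs ⟫ ⟩ ↠ ⟨ K , lookup xs i ⟩
simulate-proj zero    (x ∷ xs) K = by (cong ⟨ K ,_⟩ (π₁-pair x ⟪ xs ⟫))
simulate-proj (suc i) (x ∷ xs) K =
  by (exec-comp _ _ K _) ⨾ by (cong ⟨ _ ,_⟩ (π₂-pair x ⟪ xs ⟫)) ⨾ simulate-proj i xs K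

-- No converse is needed: eval is itself computable, so any total function it computes is computable.
mutual

  simulate : ∀ {m} {p : Rec 0 m} {xs y} → [] ⊢ p [ xs ]↓ y →
             ∀ K → ⟨ push ⌜ p ⌝ K , ⟪ xs ⟫ ⟩ ↠ ⟨ K , y ⟩
  simulate zero↓ K = by refl
  simulate (suc↓ {x}) K = by (cong (λ z → ⟨ K , suc z ⟩) (π₁-pair x 0))
  simulate (proj↓ {i = i} {xs}) K = simulate-proj i xs K
  simulate (comp↓ gs f) K = by (exec-comp _ _ K _) ⨾ simulate* gs _ ⨾ simulate f K
  simulate (prec↓0 {f = f} {g} {xs} d) K = by eq ⨾ simulate d K
    where
    eq : exec 8 ⟨ ⌜ f ⌝ , ⌜ g ⌝ ⟩ K ⟨ 0 , ⟪ xs ⟫ ⟩ ≡ ⟨ push ⌜ f ⌝ K , ⟪ xs ⟫ ⟩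
    eq rewrite π₁-pair 0 ⟪ xs ⟫ | π₂-pair 0 ⟪ xs ⟫ | π₁-pair ⌜ f ⌝ ⌜ g ⌝ = refl
  simulate (prec↓s {f = f} {g} {n} {xs} {y} d e) K = by eq ⨾ simulate d _ ⨾ by eq′ ⨾ simulate e K
    where
    a = ⟨ ⌜ f ⌝ , ⌜ g ⌝ ⟩
    nxs = ⟨ n , ⟪ xs ⟫ ⟩
    eq : exec 8 a K ⟨ suc n , ⟪ xs ⟫ ⟩ ≡ ⟨ push ⟨ 8 , a ⟩ (push ⟨ 9 , ⟨ ⌜ g ⌝ , nxs ⟩ ⟩ K) , nxs ⟩
    eq rewrite π₁-pair (suc n) ⟪ xs ⟫ | π₂-pair (suc n) ⟪ xs ⟫ | π₂-pair ⌜ f ⌝ ⌜ g ⌝ = refl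
    eq′ : exec 9 ⟨ ⌜ g ⌝ , nxs ⟩ K y ≡ ⟨ push ⌜ g ⌝ K , ⟨ n , ⟨ y , ⟪ xs ⟫ ⟩ ⟩ ⟩
    eq′ rewrite π₁-pair ⌜ g ⌝ nxs | π₂-pair ⌜ g ⌝ nxs | π₁-pair n ⟪ xs ⟫ | π₂-pair n ⟪ xs ⟫ = refl
  simulate (μ↓ {f = f} {xs} {n} below at) K = by refl ⨾ search n 0 (+-identityʳ n)
    where
    F = ⌜ f ⌝
    found : ∀ i → exec 12 ⟨ F , ⟨ i , ⟪ xs ⟫ ⟩ ⟩ K 0 ≡ ⟨ K , i ⟩
    found i rewrite π₂-pair F ⟨ i , ⟪ xs ⟫ ⟩ | π₁-pair i ⟪ xs ⟫ = refl
    next : ∀ i y → exec 12 ⟨ F , ⟨ i , ⟪ xs ⟫ ⟩ ⟩ K (suc y) ≡ ⟨ push ⟨ 11 , F ⟩ K , ⟨ suc i , ⟪ xs ⟫ ⟩ ⟩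
    next i y rewrite π₁-pair F ⟨ i , ⟪ xs ⟫ ⟩ | π₂-pair F ⟨ i , ⟪ xs ⟫ ⟩ | π₁-pair i ⟪ xs ⟫ | π₂-pair i ⟪ xs ⟫ = refl
    -- Induction on the number `j` of candidates still to be rejected before `n`.
    search : ∀ j i → j + i ≡ n → ⟨ push ⟨ 11 , F ⟩ K , ⟨ i , ⟪ xs ⟫ ⟩ ⟩ ↠ ⟨ K , n ⟩
    search zero    i refl = by refl ⨾ simulate at _ ⨾ by (found n)
    search (suc j) i eq with below i (≤-trans (s≤s (m≤n+m i j)) (≤-reflexive eq))
    ... | y , d = by refl ⨾ simulate d _ ⨾ by (next i y) ⨾ search j (suc i) (trans (+-suc j i) eq)

  simulate* : ∀ {m n} {gs : Vec (Rec 0 m) n} {xs ys} → [] ⊢ gs [ xs ]↓* ys →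
              ∀ K → ⟨ push ⌜ gs ⌝* K , ⟪ xs ⟫ ⟩ ↠ ⟨ K , ⟪ ys ⟫ ⟩
  simulate* []↓ K = by refl
  simulate* (∷↓ {g = g} {gs} {xs} {y} d ds) K = by eq ⨾ simulate d _ ⨾ by eq′ ⨾ simulate* ds _ ⨾ by refl
    where
    eq : exec 5 ⟨ ⌜ g ⌝ , ⌜ gs ⌝* ⟩ K ⟪ xs ⟫ ≡ ⟨ push ⌜ g ⌝ (push ⟨ 6 , ⟨ ⌜ gs ⌝* , ⟪ xs ⟫ ⟩ ⟩ K) , ⟪ xs ⟫ ⟩
    eq rewrite π₁-pair ⌜ g ⌝ ⌜ gs ⌝* | π₂-pair ⌜ g ⌝ ⌜ gs ⌝* = refl
    eq′ : exec 6 ⟨ ⌜ gs ⌝* , ⟪ xs ⟫ ⟩ K y ≡ ⟨ push ⌜ gs ⌝* (push ⟨ 7 , y ⟩ K) , ⟪ xs ⟫ ⟩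
    eq′ rewrite π₁-pair ⌜ gs ⌝* ⟪ xs ⟫ | π₂-pair ⌜ gs ⌝* ⟪ xs ⟫ = refl

eval-complete : ∀ (p : Rec 0 1) {n y} → [] ⊢ p [ n ∷ [] ]↓ y → ∃[ s ] eval s ⌜ p ⌝ n ≡ suc y
eval-complete p {n} {y} d with simulate d 0
... | s , eq = s , trans (cong output eq) out
  where
  out : output ⟨ 0 , y ⟩ ≡ suc y
  out rewrite π₁-pair 0 y | π₂-pair 0 y = refl

halted : ∀ {c y} → output c ≡ suc y → transition c ≡ c
halted {c} eq with π₁ c
... | zero = refl

-- A positive output means an empty stack, and from there the machine no longer moves.
eval-mono : ∀ t {s p n y} → eval s p n ≡ suc y → eval (t + s) p n ≡ suc y
eval-mono zero    eq = eq
eval-mono (suc t) eq = trans (cong output (halted (eval-mono t eq))) (eval-mono t eq)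

eval-functional : ∀ s t {p n y z} → eval s p n ≡ suc y → eval t p n ≡ suc z → y ≡ z
eval-functional s t {p} {n} eq eq′ = suc-injective
  (trans (sym (eval-mono t eq)) (trans (cong (λ u → eval u p n) (+-comm t s)) (eval-mono s eq′)))

-- 1-equivalence

Computable⇒Fun : ∀ {f} → Computable f → Fun 0 1 (λ _ v → f (lookup v 0F))
Computable⇒Fun (p , p↓) = mkFun p λ { [] (n ∷ []) → p↓ n }

Fun⇒Computable : ∀ {f} → Fun 0 1 (λ _ v → f (lookup v 0F)) → Computable f
Fun⇒Computable F = prog F , λ n → correct F [] (n ∷ [])

-- Unbounded search turns a ∀∃ statement with computable matrix into a computable choice function,
-- even when the given witnesses are not computable.
minimize : ∀ {r} → Fun 0 2 r → (∀ n → ∃[ s ] r [] (s ∷ n ∷ []) ≡ 0) →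
           ∃[ g ] Computable g × (∀ n → r [] (g n ∷ n ∷ []) ≡ 0)
minimize R ex = (λ n → proj₁ (found n)) , (μ (prog R) , λ n → proj₂ (proj₂ (found n)))
                                        , λ n → proj₁ (proj₂ (found n))
  where
  found = λ n → μ-halts R [] (n ∷ []) (proj₁ (ex n)) (proj₂ (ex n))

inverse⇒bijective : ∀ {f g : ℕ → ℕ} → (∀ n → g (f n) ≡ n) → (∀ n → f (g n) ≡ n) → Bijective _≡_ _≡_ f
inverse⇒bijective {f} {g} gf fg =
  (λ {x} {y} eq → trans (sym (gf x)) (trans (cong g eq) (gf y))) , λ n → g n , λ { refl → fg n }

-- The preimage of `n` is found by search; this gives one composite, and injectivity gives the
-- other.
computable-inverse : ∀ {f} → Computable f → Bijective _≡_ _≡_ f →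
                     ∃[ g ] Computable g × (∀ n → g (f n) ≡ n) × (∀ n → f (g n) ≡ n)
computable-inverse {f} f-comp (inj , surj)
  with minimize (distF ⦅ Computable⇒Fun f-comp ⦅ var 0F ∷ [] ⦆ ∷ var 1F ∷ [] ⦆)
         (λ n → proj₁ (surj n) , trans (cong (λ m → dist m n) (proj₂ (surj n) refl)) (dist-self n))
... | g , g-comp , eq = g , g-comp , (λ n → inj (fg (f n))) , fg
  where
  fg : ∀ n → f (g n) ≡ n
  fg n = dist≡0⇒≡ _ _ (eq n)

T-⇔⇒≡ : ∀ {a b} → T a ⇔ T b → a ≡ b
T-⇔⇒≡ {false} {false} _   = refl
T-⇔⇒≡ {true}  {true}  _   = refl
T-⇔⇒≡ {false} {true}  a⇔b = ⊥-elim (Equivalence.from a⇔b tt)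
T-⇔⇒≡ {true}  {false} a⇔b = ⊥-elim (Equivalence.to a⇔b tt)

infix 4 _≅_

-- 1-equivalence as a record, so that the two sets can be inferred from a proof.
record _≅_ (A B : Cantor) : Set where
  field
    f g    : ℕ → ℕ
    f-comp : Computable f
    g-comp : Computable g
    gf     : ∀ n → g (f n) ≡ n
    fg     : ∀ n → f (g n) ≡ n
    reduce : ∀ n → A n ≡ B (f n)

mk≅ : ∀ {A B f} → Computable f → Bijective _≡_ _≡_ f → (∀ n → A n ≡ B (f n)) → A ≅ B
mk≅ f-comp bij eq with computable-inverse f-comp bij
... | g , g-comp , gf , fg = record
  { f-comp = f-comp ; g-comp = g-comp ; gf = gf ; fg = fg ; reduce = eq }

≡₁⇒≅ : ∀ {A B} → A ≡₁ B → A ≅ B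
≡₁⇒≅ (f , f-comp , bij , A⇔B) = mk≅ f-comp bij λ n → T-⇔⇒≡ (A⇔B n)

≅⇒≡₁ : ∀ {A B} → A ≅ B → A ≡₁ B
≅⇒≡₁ A≅B = f , f-comp , inverse⇒bijective gf fg , λ n → mk⇔ (subst T (reduce n)) (subst T (sym (reduce n)))
  where open _≅_ A≅B

≈⇒≅ : ∀ {A B} → (∀ n → A n ≡ B n) → A ≅ B
≈⇒≅ = mk≅ (Fun⇒Computable (var 0F)) (inverse⇒bijective (λ _ → refl) (λ _ → refl))

≅-sym : ∀ {A B} → A ≅ B → B ≅ A
≅-sym {A} {B} A≅B = record
  { f-comp = g-comp ; g-comp = f-comp ; gf = fg ; fg = gf
  ; reduce = λ n → trans (cong B (sym (fg n))) (sym (reduce (g n))) }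
  where open _≅_ A≅B

≅-trans : ∀ {A B C} → A ≅ B → B ≅ C → A ≅ C
≅-trans A≅B B≅C = mk≅
  (Fun⇒Computable (Computable⇒Fun R₂.f-comp ⦅ Computable⇒Fun R₁.f-comp ∷ [] ⦆))
  (inverse⇒bijective {g = R₁.g ∘ R₂.g} (λ n → trans (cong R₁.g (R₂.gf _)) (R₁.gf n))
                                       (λ n → trans (cong R₂.f (R₁.fg _)) (R₂.fg n)))
  (λ n → trans (R₁.reduce n) (R₂.reduce _))
  where
  module R₁ = _≅_ A≅B
  module R₂ = _≅_ B≅C

-- Transpositions.

swap : (a b i : ℕ) → ℕ
swap a b i = ifz (dist i a) b (ifz (dist i b) a i)

swap-computable : ∀ a b → Computable (swap a b)
swap-computable a b = Fun⇒Computable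
  (if₀ distF ⦅ var 0F ∷ constF a ∷ [] ⦆ then constF b
   else (if₀ distF ⦅ var 0F ∷ constF b ∷ [] ⦆ then constF a else var 0F))

ifz-≡ : ∀ {m n x y} → m ≡ n → ifz (dist m n) x y ≡ x
ifz-≡ {m} refl rewrite dist-self m = refl

ifz-≢ : ∀ {m n x y} → m ≢ n → ifz (dist m n) x y ≡ y
ifz-≢ {m} {n} m≢n with dist m n in eq
... | zero  = contradiction (dist≡0⇒≡ m n eq) m≢n
... | suc _ = refl

swap-left : ∀ a b → swap a b a ≡ b
swap-left a b = ifz-≡ {a} refl

swap-right : ∀ a b → swap a b b ≡ a
swap-right a b with b ≟ a
... | yes refl = ifz-≡ {b} refl
... | no b≢a  = trans (ifz-≢ b≢a) (ifz-≡ {b} refl)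

swap-other : ∀ {a b i} → i ≢ a → i ≢ b → swap a b i ≡ i
swap-other i≢a i≢b = trans (ifz-≢ i≢a) (ifz-≢ i≢b)

swap-involutive : ∀ a b i → swap a b (swap a b i) ≡ i
swap-involutive a b i with i ≟ a | i ≟ b
... | yes refl | _        = trans (cong (swap a b) (swap-left a b)) (swap-right a b)
... | no _     | yes refl = trans (cong (swap a b) (swap-right a b)) (swap-left a b)
... | no i≢a   | no i≢b   = trans (cong (swap a b) (swap-other i≢a i≢b)) (swap-other i≢a i≢b)

swap-≅ : ∀ a b {A B} → (∀ i → A i ≡ B (swap a b i)) → A ≅ B
swap-≅ a b = mk≅ (swap-computable a b) (inverse⇒bijective (swap-involutive a b) (swap-involutive a b))

-- Counting and sorting

count : Cantor → ℕ → ℕ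
count C n = sum< n (λ i → bit (C i))

bit≤1 : ∀ b → bit b ≤ 1
bit≤1 false = z≤n
bit≤1 true  = ≤-refl

bit-injective : ∀ {a b} → bit a ≡ bit b → a ≡ b
bit-injective {false} {false} _ = refl
bit-injective {true}  {true}  _ = refl

count≤ : ∀ C n → count C n ≤ n
count≤ C zero    = z≤n
count≤ C (suc n) = ≤-trans (+-mono-≤ (count≤ C n) (bit≤1 (C n))) (≤-reflexive (+-comm n 1))

count-mono : ∀ C {m n} → m ≤ n → count C m ≤ count C n
count-mono C {m} {zero}  z≤n = z≤n
count-mono C {m} {suc n} m≤1+n with m≤n⇒m<n∨m≡n m≤1+n
... | inj₁ m<1+n = ≤-trans (count-mono C (≤-pred m<1+n)) (m≤m+n _ _)
... | inj₂ refl  = ≤-refl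

count-complement : ∀ C n → count (not ∘ C) n + count C n ≡ n
count-complement C zero = refl
count-complement C (suc n) with C n
... | false = trans (cong₂ _+_ (+-comm (count (not ∘ C) n) 1) (+-identityʳ (count C n))) (cong suc (count-complement C n))
... | true  = trans (cong₂ _+_ (+-identityʳ (count (not ∘ C) n)) (+-comm (count C n) 1))
                    (trans (+-suc _ _) (cong suc (count-complement C n)))

-- Ones come first. The new prefix depends only on the number of ones below `N`, so it is a normal
-- form for prefixes up to rearrangement.
sorted : ℕ → Cantor → Cantor
sorted N C i = if does (i <? N) then does (i <? count C N) else C i

sorted-low : ∀ N C {i} → i < count C N → sorted N C i ≡ true
sorted-low N C {i} i<K
  rewrite dec-true (i <? N) (<-≤-trans i<K (count≤ C N)) | dec-true (i <? count C N) i<K = refl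

sorted-mid : ∀ N C {i} → count C N ≤ i → i < N → sorted N C i ≡ false
sorted-mid N C {i} K≤i i<N
  rewrite dec-true (i <? N) i<N | dec-false (i <? count C N) (≤⇒≯ K≤i) = refl

sorted-high : ∀ N C {i} → N ≤ i → sorted N C i ≡ C i
sorted-high N C {i} N≤i rewrite dec-false (i <? N) (≤⇒≯ N≤i) = refl

-- Appending a 1 to 1^K 0^(N-K) is repaired by exchanging positions K and N.
≅-sorted : ∀ N C → sorted N C ≅ C
≅-sorted zero    C = ≈⇒≅ λ _ → refl
≅-sorted (suc N) C with C N ≟ᵇ false
-- A trailing 0 is already in its sorted place.
... | yes CN = ≅-trans (≈⇒≅ eq) (≅-sorted N C)
  where
  K = count C N
  K′≡K : count C (suc N) ≡ K
  K′≡K = trans (cong (λ b → K + bit b) CN) (+-identityʳ K)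
  eq : ∀ i → sorted (suc N) C i ≡ sorted N C i
  eq i with <-cmp i N | i <? K
  ... | tri≈ _ refl _ | _ = trans (sorted-mid (suc N) C (≤-trans (≤-reflexive K′≡K) (count≤ C N)) ≤-refl)
                                  (sym (trans (sorted-high N C ≤-refl) CN))
  ... | tri> _ _ N<i | _ = trans (sorted-high (suc N) C N<i) (sym (sorted-high N C (<⇒≤ N<i)))
  ... | tri< i<N _ _ | yes i<K = trans (sorted-low (suc N) C (<-≤-trans i<K (≤-reflexive (sym K′≡K))))
                                       (sym (sorted-low N C i<K))
  ... | tri< i<N _ _ | no i≮K = trans (sorted-mid (suc N) C (≤-trans (≤-reflexive K′≡K) (≮⇒≥ i≮K)) (m<n⇒m<1+n i<N))
                                      (sym (sorted-mid N C (≮⇒≥ i≮K) i<N))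
... | no CN≢false = ≅-trans (swap-≅ K N eq) (≅-sorted N C)
  where
  CN = ¬-not CN≢false
  K = count C N
  K′≡1+K : count C (suc N) ≡ suc K
  K′≡1+K = trans (cong (λ b → K + bit b) CN) (+-comm K 1)
  other : ∀ i → i ≢ K → i ≢ N → sorted (suc N) C i ≡ sorted N C i
  other i i≢K i≢N with <-cmp i N | <-cmp i K
  ... | tri≈ _ i≡N _ | _ = contradiction i≡N i≢N
  ... | _ | tri≈ _ i≡K _ = contradiction i≡K i≢K
  ... | tri> _ _ N<i | _ = trans (sorted-high (suc N) C N<i) (sym (sorted-high N C (<⇒≤ N<i)))
  ... | tri< _ _ _ | tri< i<K _ _ = trans (sorted-low (suc N) C (<-≤-trans (m<n⇒m<1+n i<K) (≤-reflexive (sym K′≡1+K))))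
                                          (sym (sorted-low N C i<K))
  ... | tri< i<N _ _ | tri> _ _ K<i = trans (sorted-mid (suc N) C (≤-trans (≤-reflexive K′≡1+K) K<i) (m<n⇒m<1+n i<N))
                                            (sym (sorted-mid N C (<⇒≤ K<i) i<N))
  eq : ∀ i → sorted (suc N) C i ≡ sorted N C (swap K N i)
  eq i with i ≟ K | i ≟ N
  -- This clause also covers `K` = `N`, where the prefix is all ones and the exchange is trivial.
  ... | yes refl | _ = trans (sorted-low (suc N) C (≤-reflexive (sym K′≡1+K)))
                             (sym (trans (cong (sorted N C) (swap-left K N)) (trans (sorted-high N C ≤-refl) CN)))
  ... | no N≢K | yes refl = trans (sorted-mid (suc N) C (≤-trans (≤-reflexive K′≡1+K) K<N) ≤-refl)
                                  (sym (trans (cong (sorted N C) (swap-right K N)) (sorted-mid N C ≤-refl K<N)))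
    where K<N = ≤∧≢⇒< (count≤ C N) (N≢K ∘ sym)
  ... | no i≢K | no i≢N = trans (other i i≢K i≢N) (cong (sorted N C) (sym (swap-other i≢K i≢N)))

-- Equal counts give the same sorted prefix and the tails agree, so both sets sort to one and the
-- same set.
balanced⇒≅ : ∀ {A B} N → count A N ≡ count B N → (∀ n → N ≤ n → A n ≡ B n) → A ≅ B
balanced⇒≅ {A} {B} N bal agree =
  ≅-trans (≅-sym (≅-sorted N A)) (≅-trans (≈⇒≅ eq) (≅-sorted N B))
  where
  eq : ∀ i → sorted N A i ≡ sorted N B i
  eq i with i <? N
  ... | yes i<N rewrite dec-true (i <? N) i<N | bal = refl
  ... | no i≮N = trans (sorted-high N A (≮⇒≥ i≮N)) (trans (agree i (≮⇒≥ i≮N)) (sym (sorted-high N B (≮⇒≥ i≮N))))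

-- Codes and patches

-- The shift by 2 keeps 0 and 1 in the constant block. The value on the block is left free, so
-- complements have the same code.
record HasCode (C : Cantor) (e : ℕ) : Set where
  constructor hasCode
  field
    constant : ∀ i → i < 2 + e → C i ≡ C 0
    change   : C (2 + e) ≢ C 0

-- Of two different codes, the smaller would place its change inside the constant block of the
-- larger.
code-unique : ∀ {C e e′} → HasCode C e → HasCode C e′ → e ≡ e′
code-unique {e = e} {e′} (hasCode const change) (hasCode const′ change′) with <-cmp e e′
... | tri≈ _ eq _ = eq
... | tri< e<e′ _ _ = contradiction (const′ (2 + e) (s≤s (s≤s e<e′))) change
... | tri> _ _ e′<e = contradiction (const (2 + e′) (s≤s (s≤s e′<e))) change′

record Patch (e : ℕ) (C A : Cantor) : Set where
  field
    code     : HasCode C e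
    N        : ℕ
    large    : 3 + e ≤ N
    balanced : count C N ≡ count A N
    agree    : ∀ n → N ≤ n → C n ≡ A n
    minimal  : ∀ n → 3 + e ≤ n → n < N → count C n ≢ count A n

-- Complementing replaces a count c below n by n - c on both sides, so balanced positions stay
-- balanced and unbalanced ones stay unbalanced.
Patch-complement : ∀ {e C A} → Patch e C (not ∘ A) → Patch e (not ∘ C) A
Patch-complement {e} {C} {A} P = record
  { code     = hasCode (λ i i<2+e → cong not (constant i i<2+e)) (change ∘ not-injective)
  ; N        = N
  ; large    = large
  ; balanced = from N balanced
  ; agree    = λ n N≤n → trans (cong not (agree n N≤n)) (not-involutive (A n))
  ; minimal  = λ n lo hi eq → minimal n lo hi (to n eq)
  }
  where
  open Patch P
  open HasCode code
  from : ∀ n → count C n ≡ count (not ∘ A) n → count (not ∘ C) n ≡ count A n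
  from n eq = +-cancelʳ-≡ (count C n) _ _
    (trans (count-complement C n) (trans (sym (count-complement A n)) (trans (+-comm _ (count A n)) (cong (count A n +_) (sym eq)))))
  to : ∀ n → count (not ∘ C) n ≡ count A n → count C n ≡ count (not ∘ A) n
  to n eq = +-cancelʳ-≡ (count A n) _ _
    (trans (trans (cong (count C n +_) (sym eq)) (trans (+-comm (count C n) _) (count-complement C n)))
           (sym (count-complement A n)))

splice : ℕ → Cantor → Cantor → Cantor
splice N C A i = if does (i <? N) then C i else A i

splice-low : ∀ N C A {i} → i < N → splice N C A i ≡ C i
splice-low N C A {i} i<N rewrite dec-true (i <? N) i<N = refl

splice-high : ∀ N C A {i} → N ≤ i → splice N C A i ≡ A i
splice-high N C A {i} N≤i rewrite dec-false (i <? N) (≤⇒≯ N≤i) = refl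

count-splice : ∀ N C A n → n ≤ N → count (splice N C A) n ≡ count C n
count-splice N C A n n≤N = sum<-cong n λ i i<n → cong bit (splice-low N C A (<-≤-trans i<n n≤N))

-- `M` need not be the first balanced position, so `C` is cut at the first one past the code and
-- continued by `A`. The summand `3 + e ∸ n` keeps the search from stopping inside the code.
balanced⇒Patch : ∀ {e C A} M → HasCode C e → 3 + e ≤ M → count C M ≡ count A M → ∃[ C′ ] Patch e C′ A
balanced⇒Patch {e} {C} {A} M (hasCode const change) large bal
  with least-zero (λ n → (3 + e ∸ n) + dist (count C n) (count A n)) M
         (cong₂ _+_ (m≤n⇒m∸n≡0 large) (trans (cong (λ c → dist c (count A M)) bal) (dist-self (count A M))))
... | N , at , below = splice N C A , record
  { code     = hasCode (λ i i<2+e → trans (low (m<n⇒m<1+n i<2+e)) (trans (const i i<2+e) (sym (low (s≤s z≤n)))))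
                       (λ eq → change (trans (sym (low ≤-refl)) (trans eq (low (s≤s z≤n)))))
  ; N        = N
  ; large    = large′
  ; balanced = trans (count-splice N C A N ≤-refl) (dist≡0⇒≡ _ _ (m+n≡0⇒n≡0 (3 + e ∸ N) at))
  ; agree    = λ n → splice-high N C A
  ; minimal  = λ n lo n<N eq → contradiction
      (trans (sym (proj₂ (below n n<N)))
             (cong₂ _+_ (m≤n⇒m∸n≡0 lo) (trans (cong (λ c → dist c (count A n)) (trans (sym (count-splice N C A n (<⇒≤ n<N))) eq)) (dist-self (count A n)))))
      λ ()
  }
  where
  large′ : 3 + e ≤ N
  large′ = m∸n≡0⇒m≤n (m+n≡0⇒m≡0 (3 + e ∸ N) at)
  low : ∀ {i} → i < 3 + e → splice N C A i ≡ C i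
  low i<3+e = splice-low N C A (<-≤-trans i<3+e large′)

-- Blocks of ones, and the existence of patches.

interval : ℕ → ℕ → Cantor
interval a K i = if does (i <? a) then false else does (i <? a + K)

interval-below : ∀ a K {i} → i < a → interval a K i ≡ false
interval-below a K {i} i<a rewrite dec-true (i <? a) i<a = refl

interval-in : ∀ a K {i} → a ≤ i → i < a + K → interval a K i ≡ true
interval-in a K {i} a≤i i<a+K rewrite dec-false (i <? a) (≤⇒≯ a≤i) = dec-true (i <? a + K) i<a+K

interval-above : ∀ a K {i} → a + K ≤ i → interval a K i ≡ false
interval-above a K {i} a+K≤i
  rewrite dec-false (i <? a) (≤⇒≯ (≤-trans (m≤m+n a K) a+K≤i)) = dec-false (i <? a + K) (≤⇒≯ a+K≤i)

count-interval : ∀ a K m → count (interval a K) (m + (K + a)) ≡ K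
count-interval a K zero = inside K ≤-refl
  where
  inside : ∀ j → j ≤ K → count (interval a K) (j + a) ≡ j
  inside zero    _   = sum<≡0 a λ i i<a → cong bit (interval-below a K i<a)
  inside (suc j) j<K = trans
    (cong₂ _+_ (inside j (<⇒≤ j<K))
               (cong bit (interval-in a K (m≤n+m a j) (≤-trans (+-monoˡ-≤ a j<K) (≤-reflexive (+-comm K a))))))
    (+-comm j 1)
count-interval a K (suc m) = trans
  (cong₂ _+_ (count-interval a K m)
             (cong bit (interval-above a K (≤-trans (≤-reflexive (+-comm a K)) (m≤n+m (K + a) m)))))
  (+-identityʳ K)

unbounded⇒count : ∀ {A} → (∀ m → ∃[ n ] m ≤ n × A n ≡ true) → ∀ t → ∃[ N ] t ≤ count A N
unbounded⇒count unb zero = 0 , z≤n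
unbounded⇒count {A} unb (suc t) with unbounded⇒count {A} unb t
... | M , t≤ with unb M
...   | n , M≤n , An = suc n ,
  ≤-trans (≤-reflexive (+-comm 1 t)) (+-mono-≤ (≤-trans t≤ (count-mono A M≤n)) (≤-reflexive (cong bit (sym An))))

-- With K ones and at least e + 2 zeros below M, rearrange the values below M to 0^(e+2) 1^K 0^m.
patch-zeros : ∀ {A k} → A k ≡ true → (∀ m → ∃[ n ] m ≤ n × A n ≡ false) → ∀ e → ∃[ C ] Patch e C A
patch-zeros {A} {k} Ak unb e
  with unbounded⇒count {not ∘ A} (λ m → let n , m≤n , An = unb m in n , m≤n , cong not An) (2 + e)
... | M₀ , enough = balanced⇒Patch M
  (hasCode (λ i i<2+e → trans (interval-below a K i<2+e) (sym zeroth))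
           (λ eq → contradiction (trans (sym (interval-in a K ≤-refl (m<m+n a 1≤K))) (trans eq zeroth)) λ ()))
  (≤-trans (≤-reflexive (+-comm 1 a)) (≤-trans (+-mono-≤ zeros 1≤K) (≤-reflexive (count-complement A M))))
  (trans (cong (count (interval a K)) M≡) (count-interval a K (count (not ∘ A) M ∸ a)))
  where
  a = 2 + e
  -- `M₀` provides the zeros for the block; adding `suc k` ensures that the one at `k` is counted.
  M = M₀ + suc k
  K = count A M
  zeroth : interval a K 0 ≡ false
  zeroth = interval-below a K (s≤s z≤n)
  zeros : a ≤ count (not ∘ A) M
  zeros = ≤-trans enough (count-mono (not ∘ A) (m≤m+n M₀ (suc k)))
  1≤K : 1 ≤ K
  1≤K = ≤-trans (≤-trans (≤-reflexive (cong bit (sym Ak))) (m≤n+m _ (count A k)))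
                (count-mono A (m≤n+m (suc k) M₀))
  M≡ : M ≡ (count (not ∘ A) M ∸ a) + (K + a)
  M≡ = trans (sym (count-complement A M))
         (trans (cong (_+ K) (sym (m∸n+n≡m zeros)))
           (trans (+-assoc _ a K) (cong (count (not ∘ A) M ∸ a +_) (+-comm a K))))

≢⇒attained : (A : Cantor) → ∀ {i j} → A i ≢ A j → ∀ b → ∃[ k ] A k ≡ b
≢⇒attained A {i} {j} ne b with A i in eqᵢ | A j in eqⱼ | b
... | false | false | _     = contradiction refl ne
... | true  | true  | _     = contradiction refl ne
... | false | true  | false = i , eqᵢ
... | false | true  | true  = j , eqⱼ
... | true  | false | false = j , eqⱼ
... | true  | false | true  = i , eqᵢ

-- If the zeros of `A` are bounded, its ones are unbounded, and a patch of the complement is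
-- complemented back.
patch-exists : ExcludedMiddle 0ℓ → ∀ {A i j} → A i ≢ A j → ∀ e → ∃[ C ] Patch e C A
patch-exists em {A} ne e with em {∀ m → ∃[ n ] m ≤ n × A n ≡ false}
... | yes unb = patch-zeros (proj₂ (≢⇒attained A ne true)) unb e
... | no ¬unb = let C , P = patch-zeros (cong not (proj₂ (≢⇒attained A ne false))) unb′ e
                in not ∘ C , Patch-complement P
  where
  unb′ : ∀ m → ∃[ n ] m ≤ n × not (A n) ≡ false
  unb′ m with em {∃[ n ] m ≤ n × A n ≡ true}
  ... | yes (n , m≤n , An) = n , m≤n , cong not An
  ... | no none = contradiction
    (λ m′ → m′ + m , m≤m+n m′ m , ¬-not λ An → none (m′ + m , m≤n+m m m′ , An)) ¬unb

-- Edges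

-- An unfinished computation is read as the value 0; `defined` below rules this out at every
-- position where `Checked` uses `pull`.
pull : Cantor → (s p i : ℕ) → ℕ
pull X s p i = bit (X (pred (eval s p i)))

-- p and q code a bijection f and its inverse, and C is a finite rearrangement of X ∘ f.  The last three
-- fields locate the end of the rearrangement: from 3 + e on, equal counts must stay equal.
record Checked (X C : Cantor) (p q n e s N d : ℕ) : Set where
  field
    code     : HasCode C e
    differ   : X d ≢ C d
    -- The bound covers the positions below `N`, for `balanced`, and those up to `n`, for `agree`.
    defined  : ∀ i → i < N + suc n → ∃[ y ] eval s p i ≡ suc y
    left     : eval s q (pred (eval s p n)) ≡ suc n
    right    : eval s p (pred (eval s q n)) ≡ suc n
    large    : 3 + e ≤ N
    balanced : count C N ≡ sum< N (pull X s p)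
    agree    : 3 + e ≤ n → count C n ≡ sum< n (pull X s p) → bit (C n) ≡ pull X s p n

-- Arithmetization of the edge condition.

codeDefect : Cantor → ℕ → ℕ
codeDefect C e = sum< (2 + e) (λ i → dist (bit (C i)) (bit (C 0))) + (1 ∸ dist (bit (C (2 + e))) (bit (C 0)))

-- One summand per field of `Checked`, in the same order, vanishing exactly when the field holds.
-- Inequality of bits becomes `1 ∸ dist`, and the final implication becomes an `ifz` that defaults
-- to 0.
defect : Cantor → Cantor → (p q n e s N d : ℕ) → ℕ
defect X C p q n e s N d =
  codeDefect C e
  + ((1 ∸ dist (bit (X d)) (bit (C d)))
  + (sum< (N + suc n) (λ i → ifz (eval s p i) 1 0)
  + (dist (eval s q (pred (eval s p n))) (suc n)
  + (dist (eval s p (pred (eval s q n))) (suc n)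
  + ((3 + e ∸ N)
  + (dist (count C N) (sum< N (pull X s p))
  + ifz ((3 + e ∸ n) + dist (count C n) (sum< n (pull X s p))) (dist (bit (C n)) (pull X s p n)) 0))))))

≡⇒dist≡0 : ∀ {m n} → m ≡ n → dist m n ≡ 0
≡⇒dist≡0 {m} refl = dist-self m

split≡0 : ∀ m {n} → m + n ≡ 0 → m ≡ 0 × n ≡ 0
split≡0 m eq = m+n≡0⇒m≡0 m eq , m+n≡0⇒n≡0 m eq

apart⇒≢ : ∀ {a b} → 1 ∸ dist (bit a) (bit b) ≡ 0 → a ≢ b
apart⇒≢ {true}  () refl
apart⇒≢ {false} () refl

≢⇒apart : ∀ {a b} → a ≢ b → 1 ∸ dist (bit a) (bit b) ≡ 0
≢⇒apart {false} {false} ne = contradiction refl ne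
≢⇒apart {true}  {true}  ne = contradiction refl ne
≢⇒apart {false} {true}  ne = refl
≢⇒apart {true}  {false} ne = refl

codeDefect⇒HasCode : ∀ {C e} → codeDefect C e ≡ 0 → HasCode C e
codeDefect⇒HasCode {C} {e} eq with split≡0 (sum< (2 + e) _) eq
... | const , change = hasCode
  (λ i i<2+e → bit-injective (dist≡0⇒≡ _ _ (sum<≡0⁻¹ (2 + e) const i i<2+e))) (apart⇒≢ change)

HasCode⇒codeDefect : ∀ {C e} → HasCode C e → codeDefect C e ≡ 0
HasCode⇒codeDefect {C} {e} (hasCode const change) =
  cong₂ _+_ (sum<≡0 (2 + e) λ i i<2+e → ≡⇒dist≡0 (cong bit (const i i<2+e))) (≢⇒apart change)

defect⇒Checked : ∀ {X C p q n e s N d} → defect X C p q n e s N d ≡ 0 → Checked X C p q n e s N d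
defect⇒Checked {X} {C} {p} {q} {n} {e} {s} {N} {d} eq =
  let c₁ , eq = split≡0 (codeDefect C e) eq
      c₂ , eq = split≡0 (1 ∸ dist (bit (X d)) (bit (C d))) eq
      c₃ , eq = split≡0 (sum< (N + suc n) (λ i → ifz (eval s p i) 1 0)) eq
      c₄ , eq = split≡0 (dist (eval s q (pred (eval s p n))) (suc n)) eq
      c₅ , eq = split≡0 (dist (eval s p (pred (eval s q n))) (suc n)) eq
      c₆ , eq = split≡0 (3 + e ∸ N) eq
      c₇ , c₈ = split≡0 (dist (count C N) (sum< N (pull X s p))) eq
  in record
  { code     = codeDefect⇒HasCode c₁
  ; differ   = apart⇒≢ c₂
  ; defined  = λ i i< → positive (sum<≡0⁻¹ (N + suc n) c₃ i i<)
  ; left     = dist≡0⇒≡ _ _ c₄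
  ; right    = dist≡0⇒≡ _ _ c₅
  ; large    = m∸n≡0⇒m≤n c₆
  ; balanced = dist≡0⇒≡ _ _ c₇
  ; agree    = λ lo bal → dist≡0⇒≡ _ _ (trans (sym (ifz-zero (cong₂ _+_ (m≤n⇒m∸n≡0 lo) (≡⇒dist≡0 bal)))) c₈)
  }
  where
  positive : ∀ {m} → ifz m 1 0 ≡ 0 → ∃[ y ] m ≡ suc y
  positive {suc y} _ = y , refl
  ifz-zero : ∀ {m x y} → m ≡ 0 → ifz m x y ≡ x
  ifz-zero refl = refl

Checked⇒defect : ∀ {X C p q n e s N d} → Checked X C p q n e s N d → defect X C p q n e s N d ≡ 0
Checked⇒defect {X} {C} {p} {q} {n} {e} {s} {N} {d} c =
  cong₂ _+_ (HasCode⇒codeDefect code)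
  (cong₂ _+_ (≢⇒apart differ)
  (cong₂ _+_ (sum<≡0 (N + suc n) λ i i< → cong (λ m → ifz m 1 0) (proj₂ (defined i i<)))
  (cong₂ _+_ (≡⇒dist≡0 left)
  (cong₂ _+_ (≡⇒dist≡0 right)
  (cong₂ _+_ (m≤n⇒m∸n≡0 large)
  (cong₂ _+_ (≡⇒dist≡0 balanced) agreement))))))
  where
  open Checked c
  agreement : ifz ((3 + e ∸ n) + dist (count C n) (sum< n (pull X s p))) (dist (bit (C n)) (pull X s p n)) 0 ≡ 0
  agreement with (3 + e ∸ n) + dist (count C n) (sum< n (pull X s p)) in eq
  ... | suc _ = refl
  ... | zero  = let lo , bal = split≡0 (3 + e ∸ n) eq in ≡⇒dist≡0 (agree (m∸n≡0⇒m≤n lo) (dist≡0⇒≡ _ _ bal))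

countF : ∀ {k m n} (j : Fin k) → Fun k m n → Fun k m (λ Os xs → count (lookup Os j) (n Os xs))
countF j = sum<F (oracleF j ⦅ var 0F ∷ [] ⦆)

defectF : ∀ {k} (i j : Fin k) → Fun k 7 (λ Os v →
  defect (lookup Os i) (lookup Os j) (lookup v 0F) (lookup v 1F) (lookup v 2F) (lookup v 3F)
         (lookup v 4F) (lookup v 5F) (lookup v 6F))
defectF {k} i j =
     codeF
  ⊕ (constF 1 ⊝ dist′ (oracleF i ⦅ d ∷ [] ⦆) (oracleF j ⦅ d ∷ [] ⦆))
  ⊕ sum<F (if₀ evalF ⦅ var 5F ∷ var 1F ∷ var 0F ∷ [] ⦆ then constF 1 else constF 0) (N ⊕ suc′F n)
  ⊕ dist′ (evalF ⦅ s ∷ q ∷ pred′ (evalF ⦅ s ∷ p ∷ n ∷ [] ⦆) ∷ [] ⦆) (suc′F n)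
  ⊕ dist′ (evalF ⦅ s ∷ p ∷ pred′ (evalF ⦅ s ∷ q ∷ n ∷ [] ⦆) ∷ [] ⦆) (suc′F n)
  ⊕ (3+e ⊝ N)
  ⊕ dist′ (countF j N) (sum<F pullF N)
  ⊕ (if₀ (3+e ⊝ n) ⊕ dist′ (countF j n) (sum<F pullF n)
     then dist′ (oracleF j ⦅ n ∷ [] ⦆) (oracleF i ⦅ pred′ (evalF ⦅ s ∷ p ∷ n ∷ [] ⦆) ∷ [] ⦆)
     else constF 0)
  where
  infixr 6 _⊕_
  infix  7 _⊝_
  _⊕_ : ∀ {k m x y} → Fun k m x → Fun k m y → Fun k m (λ Os xs → x Os xs + y Os xs)
  X ⊕ Y = +F ⦅ X ∷ Y ∷ [] ⦆
  _⊝_ : ∀ {k m x y} → Fun k m x → Fun k m y → Fun k m (λ Os xs → x Os xs ∸ y Os xs)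
  X ⊝ Y = ∸F ⦅ X ∷ Y ∷ [] ⦆
  dist′ : ∀ {k m x y} → Fun k m x → Fun k m y → Fun k m (λ Os xs → dist (x Os xs) (y Os xs))
  dist′ X Y = distF ⦅ X ∷ Y ∷ [] ⦆
  suc′F : ∀ {k m x} → Fun k m x → Fun k m (λ Os xs → suc (x Os xs))
  suc′F X = sucF ⦅ X ∷ [] ⦆
  pred′ : ∀ {k m x} → Fun k m x → Fun k m (λ Os xs → pred (x Os xs))
  pred′ X = predF ⦅ X ∷ [] ⦆
  p = var {k} {7} 0F
  q = var {k} {7} 1F
  n = var {k} {7} 2F
  e = var {k} {7} 3F
  s = var {k} {7} 4F
  N = var {k} {7} 5F
  d = var {k} {7} 6F
  2+e = suc′F (suc′F e)
  3+e = suc′F 2+e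
  codeF = sum<F (dist′ (oracleF j ⦅ var {k} {8} 0F ∷ [] ⦆) (oracleF j ⦅ constF 0 ∷ [] ⦆)) 2+e
          ⊕ (constF 1 ⊝ dist′ (oracleF j ⦅ 2+e ∷ [] ⦆) (oracleF j ⦅ constF 0 ∷ [] ⦆))
  pullF = oracleF i ⦅ pred′ (evalF ⦅ var {k} {8} 5F ∷ var 1F ∷ var 0F ∷ [] ⦆) ∷ [] ⦆

-- `π` selects one of the two permutations listed by the code. The witnesses may vary with `n`, but
-- `code-unique` fixes `e`, and halting stages agree on values.
Edge : (ℕ → ℕ) → Cantor → Cantor → Set
Edge π X C = ∀ n → ∃[ e ] ∃[ s ] ∃[ N ] ∃[ d ] Checked X C (π₁ (π e)) (π₂ (π e)) n e s N d

Edge-cong : ∀ π {X X′ C C′} → (∀ n → X n ≡ X′ n) → (∀ n → C n ≡ C′ n) → Edge π X C → Edge π X′ C′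
Edge-cong π {X} {X′} {C} {C′} X≈ C≈ E n = let e , s , N , d , c = E n in e , s , N , d , go c
  where
  go : ∀ {p q e s N d} → Checked X C p q n e s N d → Checked X′ C′ p q n e s N d
  go {p} {q} {e} {s} {N} {d} c = record
    { code     = hasCode (λ i i<2+e → trans (sym (C≈ i)) (trans (constant i i<2+e) (C≈ 0)))
                         (λ eq → change (trans (C≈ _) (trans eq (sym (C≈ 0)))))
    ; differ   = λ eq → differ (trans (X≈ d) (trans eq (sym (C≈ d))))
    ; defined  = defined
    ; left     = left
    ; right    = right
    ; large    = large
    ; balanced = trans (sym (count≡ N)) (trans balanced (pull≡ N))
    ; agree    = λ lo bal → trans (sym (cong bit (C≈ n)))
                   (trans (agree lo (trans (count≡ n) (trans bal (sym (pull≡ n))))) (cong bit (X≈ _)))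
    }
    where
    open Checked c
    open HasCode code
    count≡ : ∀ m → count C m ≡ count C′ m
    count≡ m = sum<-cong m λ i _ → cong bit (C≈ i)
    pull≡ : ∀ m → sum< m (pull X s p) ≡ sum< m (pull X′ s p)
    pull≡ m = sum<-cong m λ i _ → cong bit (X≈ _)

Edge-differ : ∀ π {X C} → Edge π X C → ∃[ d ] X d ≢ C d
Edge-differ π E = let _ , _ , _ , d , c = E 0 in d , Checked.differ c

-- All instances share one code, hence one pair `p`, `q`; `p` computes a bijection `f`. Once `C` and
-- `X ∘ f` have equal counts at `N₀`, each balanced position forces agreement there, which balances
-- the next one.
Edge⇒≅ : ∀ π {X C} → Edge π X C → C ≅ X
Edge⇒≅ π {X} {C} E = ≅-trans
  (balanced⇒≅ N₀ (proj₁ (stable N₀ ≤-refl)) (λ n N₀≤n → proj₂ (stable n N₀≤n)))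
  (mk≅ f-comp ((λ {a} {b} → f-injective {a} {b}) , λ n → z n , λ { refl → fz n }) (λ _ → refl))
  where
  e₀ = proj₁ (E 0)
  p = π₁ (π e₀)
  q = π₂ (π e₀)
  same-code : ∀ n → ∃[ s ] ∃[ N ] ∃[ d ] Checked X C p q n e₀ s N d
  same-code n with E 0 | E n
  ... | e , _ , _ , _ , c | e′ , s , N , d , c′ with code-unique (Checked.code c′) (Checked.code c)
  ...   | refl = s , N , d , c′
  s : ℕ → ℕ
  s n = proj₁ (same-code n)
  N : ℕ → ℕ
  N n = proj₁ (proj₂ (same-code n))
  N₀ = N 0
  module Ch n = Checked (proj₂ (proj₂ (proj₂ (same-code n))))
  converges : ∀ n → ∃[ y ] eval (s n) p n ≡ suc y
  converges n = Ch.defined n n (m≤n+m (suc n) (N n))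
  -- The stages `s n` come from the hypothesis and need not be computable in `n`; a search finds
  -- computable ones.
  stage = minimize (if₀ evalF ⦅ var 0F ∷ constF p ∷ var 1F ∷ [] ⦆ then constF 1 else constF 0)
                   (λ n → s n , cong (λ m → ifz m 1 0) (proj₂ (converges n)))
  t = proj₁ stage
  f : ℕ → ℕ
  f n = pred (eval (t n) p n)
  f-comp : Computable f
  f-comp = Fun⇒Computable (predF ⦅ evalF ⦅ Computable⇒Fun (proj₁ (proj₂ stage)) ∷ constF p ∷ var 0F ∷ [] ⦆ ∷ [] ⦆)
  suc-pred′ : ∀ {m} → ifz m 1 0 ≡ 0 → m ≡ suc (pred m)
  suc-pred′ {suc m} _ = refl
  f-eval : ∀ n → eval (t n) p n ≡ suc (f n)
  f-eval n = suc-pred′ (proj₂ (proj₂ stage) n)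
  pred-eval : ∀ u i {y} → eval u p i ≡ suc y → pred (eval u p i) ≡ f i
  pred-eval u i eq = trans (cong pred eq) (eval-functional u (t i) eq (f-eval i))
  q-eval : ∀ n → eval (s n) q (f n) ≡ suc n
  q-eval n = trans (cong (eval (s n) q) (sym (pred-eval (s n) n (proj₂ (converges n))))) (Ch.left n)
  f-injective : ∀ {a b} → f a ≡ f b → a ≡ b
  f-injective {a} {b} eq =
    -- Both `a` and `b` are the value of `q` at the common image.
    eval-functional (s a) (s b) (q-eval a) (trans (cong (eval (s b) q) eq) (q-eval b))
  z : ℕ → ℕ
  z n = pred (eval (s n) q n)
  fz : ∀ n → f (z n) ≡ n
  fz n = eval-functional (t (z n)) (s n) (f-eval (z n)) (Ch.right n)
  pull≡ : ∀ n i → i < N n + suc n → pull X (s n) p i ≡ bit (X (f i))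
  pull≡ n i i< = cong (bit ∘ X) (pred-eval (s n) i (proj₂ (Ch.defined n i i<)))
  agree : ∀ n → 3 + e₀ ≤ n → count C n ≡ count (X ∘ f) n → C n ≡ X (f n)
  agree n lo bal = bit-injective
    (trans (Ch.agree n lo (trans bal (sum<-cong n λ i i<n → sym (pull≡ n i (≤-trans (m<n⇒m<1+n i<n) (m≤n+m (suc n) (N n)))))))
           (pull≡ n n (m≤n+m (suc n) (N n))))
  stable : ∀ n → N₀ ≤ n → count C n ≡ count (X ∘ f) n × C n ≡ X (f n)
  stable n N₀≤n with m≤n⇒m<n∨m≡n N₀≤n
  ... | inj₂ refl = bal , agree N₀ (Ch.large 0) bal
    where
    bal : count C N₀ ≡ count (X ∘ f) N₀
    bal = trans (Ch.balanced 0) (sum<-cong N₀ λ i i<N₀ → pull≡ 0 i (<-≤-trans i<N₀ (m≤m+n N₀ 1)))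
  stable (suc n) N₀≤n | inj₁ N₀<1+n = bal , agree (suc n) (≤-trans (Ch.large 0) N₀≤n) bal
    where
    ih = stable n (≤-pred N₀<1+n)
    bal : count C (suc n) ≡ count (X ∘ f) (suc n)
    bal = cong₂ _+_ (proj₁ ih) (cong bit (proj₂ ih))

-- Patches give edges.

index : ∀ {A B} → A ≅ B → ℕ
index A≅B = ⟨ ⌜ proj₁ f-comp ⌝ , ⌜ proj₁ g-comp ⌝ ⟩
  where open _≅_ A≅B

-- Finitely many halting computations share a stage. Allowing any extra `t` steps lets two such
-- stages be added to serve two programs at once.
uniform : ∀ {f} (f-comp : Computable f) M →
          ∃[ s ] (∀ t i → i < M → eval (t + s) ⌜ proj₁ f-comp ⌝ i ≡ suc (f i))
uniform _ zero = 0 , λ _ _ ()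
uniform {f} f-comp@(p , p↓) (suc M) with uniform f-comp M | eval-complete p (p↓ M)
... | s , below | s′ , at = s′ + s , bound
  where
  bound : ∀ t i → i < suc M → eval (t + (s′ + s)) ⌜ p ⌝ i ≡ suc (f i)
  bound t i i<1+M with m≤n⇒m<n∨m≡n (≤-pred i<1+M)
  ... | inj₁ i<M  = trans (cong (λ u → eval u ⌜ p ⌝ i) (sym (+-assoc t s′ s))) (below (t + s′) i i<M)
  ... | inj₂ refl = trans (cong (λ u → eval u ⌜ p ⌝ i) (trans (cong (t +_) (+-comm s′ s)) (sym (+-assoc t s s′))))
                          (eval-mono (t + s) at)

-- The witnesses `e`, `N` and `d` are the same for all `n`; only the stage grows, so as to cover the
-- computations inspected at `n`.
patch⇒Edge : ∀ π {e C A X} (A≅X : A ≅ X) → π e ≡ index A≅X → Patch e C A → ∃[ d ] X d ≢ C d → Edge π X C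
patch⇒Edge π {e} {C} {A} {X} A≅X πe P (d , X≢C) n =
  e , s , N , d , subst₂ (λ p q → Checked X C p q n e s N d) (sym p≡) (sym q≡) checked
  where
  open _≅_ A≅X
  open Patch P
  p = ⌜ proj₁ f-comp ⌝
  q = ⌜ proj₁ g-comp ⌝
  p≡ : π₁ (π e) ≡ p
  p≡ = trans (cong π₁ πe) (π₁-pair p q)
  q≡ : π₂ (π e) ≡ q
  q≡ = trans (cong π₂ πe) (π₂-pair p q)
  -- `p` is run at the positions below `N`, up to `n` and at `g n`; `q` is run at `f n` and at `n`.
  Mp = N + suc n + suc (g n)
  Mq = suc (f n) + suc n
  sp = uniform f-comp Mp
  sq = uniform g-comp Mq
  s = proj₁ sq + proj₁ sp
  p-eval : ∀ i → i < Mp → eval s p i ≡ suc (f i)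
  p-eval = proj₂ sp (proj₁ sq)
  q-eval : ∀ i → i < Mq → eval s q i ≡ suc (g i)
  q-eval i i< = trans (cong (λ u → eval u q i) (+-comm (proj₁ sq) (proj₁ sp))) (proj₂ sq (proj₁ sp) i i<)
  below-p : ∀ {i} → i < N + suc n → i < Mp
  below-p i< = <-≤-trans i< (m≤m+n (N + suc n) (suc (g n)))
  n< : n < N + suc n
  n< = m≤n+m (suc n) N
  pull≡ : ∀ {i} → i < N + suc n → pull X s p i ≡ bit (A i)
  pull≡ {i} i< = cong bit (trans (cong (X ∘ pred) (p-eval i (below-p i<))) (sym (reduce i)))
  checked : Checked X C p q n e s N d
  checked = record
    { code     = code
    ; differ   = X≢C
    ; defined  = λ i i< → f i , p-eval i (below-p i<)
    ; left     = trans (cong (eval s q ∘ pred) (p-eval n (below-p n<)))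
                       (trans (q-eval (f n) (m≤m+n (suc (f n)) (suc n))) (cong suc (gf n)))
    ; right    = trans (cong (eval s p ∘ pred) (q-eval n (m≤n+m (suc n) (suc (f n)))))
                       (trans (p-eval (g n) (m≤n+m (suc (g n)) (N + suc n))) (cong suc (fg n)))
    ; large    = large
    ; balanced = trans balanced (sum<-cong N λ i i<N → sym (pull≡ (<-≤-trans i<N (m≤m+n N (suc n)))))
    ; agree    = λ lo bal → trans (cong bit (agree n (late lo bal))) (sym (pull≡ n<))
    }
    where
    -- By minimality of `N`, a balanced position past the code is already beyond the rearrangement.
    late : 3 + e ≤ n → count C n ≡ sum< n (pull X s p) → N ≤ n
    late lo bal with N ≤? n
    ... | yes N≤n = N≤n
    ... | no N≰n = contradiction (trans bal (sum<-cong n λ i i<n → pull≡ (<-trans i<n n<))) (minimal n lo (≰⇒> N≰n))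

-- The normal form ∀ n ∃ w of Π⁰₂

record ∀∃ {k} (P : Vec Cantor k → Set) : Set where
  field
    {r}  : Vec Cantor k → Vec ℕ 2 → ℕ
    R    : Fun k 2 r
    to   : ∀ Os → P Os → ∀ n → ∃[ w ] r Os (w ∷ n ∷ []) ≡ 0
    from : ∀ Os → (∀ n → ∃[ w ] r Os (w ∷ n ∷ []) ≡ 0) → P Os

-- The universal quantifiers are merged by pairing, and a product vanishes when one factor does.
-- Conversely, if some `m` refutes the first condition, the pairs ⟨ m , n ⟩ establish the second for
-- every `n`.
∀∃-∪ : ∀ {k} {P Q : Vec Cantor k → Set} → ExcludedMiddle 0ℓ → ∀∃ P → ∀∃ Q → ∀∃ (λ Os → P Os ⊎ Q Os)
∀∃-∪ {k} {P} {Q} em p q = record { R = *F ⦅ r₁ ∷ r₂ ∷ [] ⦆ ; to = to ; from = from }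
  where
  module p = ∀∃ p
  module q = ∀∃ q
  r₁ = p.R ⦅ fst (var 0F) ∷ fst (var 1F) ∷ [] ⦆
  r₂ = q.R ⦅ snd (var 0F) ∷ snd (var 1F) ∷ [] ⦆
  r : Vec Cantor k → ℕ → ℕ → ℕ
  r Os w n = p.r Os (π₁ w ∷ π₁ n ∷ []) * q.r Os (π₂ w ∷ π₂ n ∷ [])
  to : ∀ Os → P Os ⊎ Q Os → ∀ n → ∃[ w ] r Os w n ≡ 0
  to Os (inj₁ x) n = let w , eq = p.to Os x (π₁ n) in
    ⟨ w , 0 ⟩ , cong (_* _) (trans (cong (λ v → p.r Os (v ∷ π₁ n ∷ [])) (π₁-pair w 0)) eq)
  to Os (inj₂ y) n = let w , eq = q.to Os y (π₂ n) in
    ⟨ 0 , w ⟩ , trans (cong (p.r Os (π₁ ⟨ 0 , w ⟩ ∷ π₁ n ∷ []) *_)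
                            (trans (cong (λ v → q.r Os (v ∷ π₂ n ∷ [])) (π₂-pair 0 w)) eq))
                      (*-zeroʳ (p.r Os (π₁ ⟨ 0 , w ⟩ ∷ π₁ n ∷ [])))
  from : ∀ Os → (∀ n → ∃[ w ] r Os w n ≡ 0) → P Os ⊎ Q Os
  from Os h with em {∃[ n ] ¬ (∃[ w ] p.r Os (w ∷ n ∷ []) ≡ 0)}
  ... | no ¬bad = inj₁ (p.from Os λ n → good n)
    where
    good : ∀ n → ∃[ w ] p.r Os (w ∷ n ∷ []) ≡ 0
    good n with em {∃[ w ] p.r Os (w ∷ n ∷ []) ≡ 0}
    ... | yes x = x
    ... | no ¬x = contradiction (n , ¬x) ¬bad
  ... | yes (m , bad) = inj₂ (q.from Os λ n → good n)
    where
    good : ∀ n → ∃[ w ] q.r Os (w ∷ n ∷ []) ≡ 0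
    good n with h ⟨ m , n ⟩
    ... | w , eq rewrite π₁-pair m n | π₂-pair m n
      with m*n≡0⇒m≡0∨n≡0 (p.r Os (π₁ w ∷ m ∷ [])) eq
    ...   | inj₁ z = contradiction (π₁ w , z) bad
    ...   | inj₂ z = π₂ w , z

-- The search for a witness `w` is a program whose domain is the inner existential condition.
∀∃⇒Π⁰₂ : ∀ {k} {P : Vec Cantor k → Set} → ∀∃ P → Π⁰₂ {k} {0} (λ Os _ → P Os)
∀∃⇒Π⁰₂ {k} {P} p = Q , (μ (prog R) , semi) , λ { Os [] → mk⇔ (to Os) (from Os) }
  where
  open ∀∃ p
  Q : PointSet k 1
  Q Os ns = ∃[ w ] r Os (w ∷ ns) ≡ 0
  semi : ∀ Os ns → Q Os ns ⇔ (∃[ y ] Os ⊢ μ (prog R) [ ns ]↓ y)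
  semi Os ns = mk⇔
    (λ { (w , eq) → let y , _ , y↓ = μ-halts R Os ns w eq in y , y↓ })
    -- Determinism identifies the zero found by the search with the value of `r`.
    (λ { (y , μ↓ _ at) → y , ↓-functional (correct R Os (y ∷ ns)) at })

Edge-∀∃ : ∀ {k} (i j : Fin k) π → Fun k 1 (λ _ v → π (lookup v 0F)) →
          ∀∃ (λ Os → Edge π (lookup Os i) (lookup Os j))
Edge-∀∃ {k} i j π πF = record
  { R    = defectF i j ⦅ fst πe ∷ snd πe ∷ var 1F ∷ e ∷ fst (snd w) ∷ fst (snd (snd w)) ∷ snd (snd (snd w)) ∷ [] ⦆
  ; to   = λ Os E n → let e , s , N , d , c = E n in
             ⟨ e , ⟨ s , ⟨ N , d ⟩ ⟩ ⟩ , trans (unpack Os n e s N d) (Checked⇒defect c)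
  ; from = λ Os h n → let w , eq = h n in
             π₁ w , π₁ (π₂ w) , π₁ (π₂ (π₂ w)) , π₂ (π₂ (π₂ w)) , defect⇒Checked eq
  }
  where
  w = var {k} {2} 0F
  e = fst w
  πe = πF ⦅ e ∷ [] ⦆
  D : Vec Cantor k → (n e s N d : ℕ) → ℕ
  D Os n e s N d = defect (lookup Os i) (lookup Os j) (π₁ (π e)) (π₂ (π e)) n e s N d
  unpack : ∀ Os n e s N d → let w = ⟨ e , ⟨ s , ⟨ N , d ⟩ ⟩ ⟩ in
           D Os n (π₁ w) (π₁ (π₂ w)) (π₁ (π₂ (π₂ w))) (π₂ (π₂ (π₂ w))) ≡ D Os n e s N d
  unpack Os n e s N d
    rewrite π₁-pair e ⟨ s , ⟨ N , d ⟩ ⟩ | π₂-pair e ⟨ s , ⟨ N , d ⟩ ⟩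
          | π₁-pair s ⟨ N , d ⟩ | π₂-pair s ⟨ N , d ⟩ | π₁-pair N d | π₂-pair N d = refl

-- The graph

open Graphs CantorSetoid using (IsSimpleGraph; Path; stop; step; Connected; DiameterAtMost)

-- Directed: the second set carries the code, and either of the two listed permutations may be used.
Arc : Rel Cantor 0ℓ
Arc X C = Edge π₁ X C ⊎ Edge π₂ X C

G : Rel Cantor 0ℓ
G X Y = Arc X Y ⊎ Arc Y X

Arc-cong : ∀ {X X′ C C′} → (∀ n → X n ≡ X′ n) → (∀ n → C n ≡ C′ n) → Arc X C → Arc X′ C′
Arc-cong X≈ C≈ (inj₁ E) = inj₁ (Edge-cong π₁ X≈ C≈ E)
Arc-cong X≈ C≈ (inj₂ E) = inj₂ (Edge-cong π₂ X≈ C≈ E)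

Arc-differ : ∀ {X C} → Arc X C → ∃[ d ] X d ≢ C d
Arc-differ (inj₁ E) = Edge-differ π₁ E
Arc-differ (inj₂ E) = Edge-differ π₂ E

Arc⇒≅ : ∀ {X C} → Arc X C → C ≅ X
Arc⇒≅ (inj₁ E) = Edge⇒≅ π₁ E
Arc⇒≅ (inj₂ E) = Edge⇒≅ π₂ E

Arc⇒HasCode : ∀ {X C} → Arc X C → ∃[ e ] HasCode C e
Arc⇒HasCode (inj₁ E) = let e , _ , _ , _ , c = E 0 in e , Checked.code c
Arc⇒HasCode (inj₂ E) = let e , _ , _ , _ , c = E 0 in e , Checked.code c

G-cong : ∀ {X X′ Y Y′} → (∀ n → X n ≡ X′ n) → (∀ n → Y n ≡ Y′ n) → G X Y → G X′ Y′
G-cong X≈ Y≈ (inj₁ a) = inj₁ (Arc-cong X≈ Y≈ a)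
G-cong X≈ Y≈ (inj₂ a) = inj₂ (Arc-cong Y≈ X≈ a)

G-swap : ∀ {X Y} → G X Y → G Y X
G-swap (inj₁ a) = inj₂ a
G-swap (inj₂ a) = inj₁ a

G⇒≅ : ∀ {X Y} → G X Y → X ≅ Y
G⇒≅ (inj₁ a) = ≅-sym (Arc⇒≅ a)
G⇒≅ (inj₂ a) = Arc⇒≅ a

G-simple : IsSimpleGraph G
G-simple = record
  { sym-edge = G-swap
  ; irrefl   = λ { X≈Y (inj₁ a) → let d , ne = Arc-differ a in ne (X≈Y d)
                 ; X≈Y (inj₂ a) → let d , ne = Arc-differ a in ne (sym (X≈Y d)) }
  ; resp-≈   = (λ Y≈ → G-cong (λ _ → refl) Y≈) , (λ X≈ → G-cong X≈ (λ _ → refl))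
  }

G-Π⁰₂ : ExcludedMiddle 0ℓ → Π⁰₂-Rel G
G-Π⁰₂ em = ∀∃⇒Π⁰₂ (∀∃-∪ em (arc 0F 1F) (arc 1F 0F))
  where
  arc : (i j : Fin 2) → ∀∃ (λ Os → Arc (lookup Os i) (lookup Os j))
  arc i j = ∀∃-∪ em (Edge-∀∃ i j π₁ π₁F) (Edge-∀∃ i j π₂ π₂F)

-- Connectedness and the upper bound for the diameter.

path⇒≅ : ∀ {n X Y} → Path G n X Y → X ≅ Y
path⇒≅ (stop X≈Y)  = ≈⇒≅ X≈Y
path⇒≅ (step g gs) = ≅-trans (G⇒≅ g) (path⇒≅ gs)

≈-or-≢ : ExcludedMiddle 0ℓ → (A B : Cantor) → (∀ n → A n ≡ B n) ⊎ (∃[ d ] A d ≢ B d)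
≈-or-≢ em A B with em {∃[ d ] A d ≢ B d}
... | yes ne = inj₂ ne
... | no all = inj₁ same
  where
  same : ∀ n → A n ≡ B n
  same n with A n ≟ᵇ B n
  ... | yes eq = eq
  ... | no ne  = contradiction (n , ne) all

-- The middle point `C` is a patch of `A` whose code lists the identity and the permutation `f` with
-- A = B ∘ f, so `C` is reached from `A` by the first and from `B` by the second.
short-path : ExcludedMiddle 0ℓ → ∀ A B → A ≅ B → ∃[ n ] n ≤ 2 × Path G n A B
short-path em A B A≅B with ≈-or-≢ em A B
... | inj₁ A≈B = 0 , z≤n , stop A≈B
... | inj₂ (d , Ad≢Bd) = join (≈-or-≢ em A C) (≈-or-≢ em B C)
  where
  open _≅_ A≅B
  id≅ : A ≅ A
  id≅ = ≈⇒≅ λ _ → refl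
  e = ⟨ index id≅ , index A≅B ⟩
  Ad≢Agd : A d ≢ A (g d)
  Ad≢Agd eq = Ad≢Bd (trans eq (trans (reduce (g d)) (cong B (fg d))))
  patched = patch-exists em {A} Ad≢Agd e
  C = proj₁ patched
  A–C : ∃[ d ] A d ≢ C d → G A C
  A–C ne = inj₁ (inj₁ (patch⇒Edge π₁ id≅ (π₁-pair _ _) (proj₂ patched) ne))
  C–B : ∃[ d ] B d ≢ C d → G C B
  C–B ne = inj₂ (inj₂ (patch⇒Edge π₂ A≅B (π₂-pair _ _) (proj₂ patched) ne))
  -- Loops are not edges, so if `C` coincides with an endpoint the corresponding step is dropped.
  join : (∀ n → A n ≡ C n) ⊎ (∃[ d ] A d ≢ C d) → (∀ n → B n ≡ C n) ⊎ (∃[ d ] B d ≢ C d) →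
         ∃[ n ] n ≤ 2 × Path G n A B
  join (inj₁ A≈C) (inj₁ B≈C) = contradiction (trans (A≈C d) (sym (B≈C d))) Ad≢Bd
  join (inj₁ A≈C) (inj₂ ne)  = 1 , s≤s z≤n , step (G-cong (sym ∘ A≈C) (λ _ → refl) (C–B ne)) (stop λ _ → refl)
  join (inj₂ ne)  (inj₁ B≈C) = 1 , s≤s z≤n , step (A–C ne) (stop (sym ∘ B≈C))
  join (inj₂ ne)  (inj₂ ne′) = 2 , ≤-refl , step (A–C ne) (step (C–B ne′) (stop λ _ → refl))

-- The lower bound for the diameter.

singleton : ℕ → Cantor
singleton n i = does (i ≟ n)

-- A set with a code is constant on {0 , 1}, so the sets {0} and {1} are not adjacent.
2≤diameter : ExcludedMiddle 0ℓ → ∀ j → DiameterAtMost G j → 2 ≤ j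
2≤diameter em j diam = bound (diam S₀ S₁ connected)
  where
  S₀ = singleton 0
  S₁ = singleton 1
  exchanged : ∀ i → S₀ i ≡ S₁ (swap 0 1 i)
  exchanged 0             = refl
  exchanged 1             = refl
  exchanged (suc (suc i)) = refl
  connected : Connected G S₀ S₁
  connected = let n , _ , path = short-path em S₀ S₁ (swap-≅ 0 1 exchanged) in n , path
  uncoded : ∀ {C e} → C 0 ≢ C 1 → ¬ HasCode C e
  uncoded ne (hasCode const _) = ne (sym (const 1 (s≤s (s≤s z≤n))))
  nonadjacent : ¬ G S₀ S₁
  nonadjacent (inj₁ a) = uncoded (λ ()) (proj₂ (Arc⇒HasCode a))
  nonadjacent (inj₂ a) = uncoded (λ ()) (proj₂ (Arc⇒HasCode a))
  bound : ∃[ n ] n ≤ j × Path G n S₀ S₁ → 2 ≤ j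
  bound (_ , _ , stop S₀≈S₁) = contradiction (S₀≈S₁ 0) λ ()
  bound (_ , _ , step g (stop Y≈S₁)) = contradiction (G-cong (λ _ → refl) Y≈S₁ g) nonadjacent
  bound (_ , n≤j , step _ (step _ _)) = ≤-trans (s≤s (s≤s z≤n)) n≤j

theorem4p1 : ExcludedMiddle 0ℓ → GraphableWithDiameter Π⁰₂-Rel _≡₁_ 2
theorem4p1 em = G , G-simple , G-Π⁰₂ em ,
  (λ A B → mk⇔ (λ A≡B → let n , _ , path = short-path em A B (≡₁⇒≅ A≡B) in n , path)
               (λ { (_ , path) → ≅⇒≡₁ (path⇒≅ path) })) ,
  (λ { A B (_ , path) → short-path em A B (path⇒≅ path) }) , 2≤diameter em
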